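{- For every integer $k \geq 4$, the graph $C_{2k}^*$ is a minimal non-UDG; that is, it is not a unit disk graph, but every proper induced subgraph of it is a unit disk graph.
   Context: All graphs are finite and simple. A graph $G=(V,E)$ is a unit disk graph (UDG) if there is a function $f:V\to\mathbb{R}^2$ such that for distinct $u,v\in V$, $uv\in E$ if and only if the Euclidean distance between $f(u)$ and $f(v)$ is at most $1$. For a bipartite graph $G=(U,W,E)$ with fixed bipartition into independent sets $U$ and $W$, $G^*$ denotes the graph obtained from $G$ by making each of $U$ and $W$ a clique and leaving the edges between $U$ and $W$ unchanged. $C_{2k}$ is the cycle on $2k$ vertices with its (unique) bipartition. -}

module Defs where

open import Data.Fin.Base using (Fin; zero; suc; toℕ)
open import Data.Fin.Properties using (toℕ<n)
open import Data.Fin.Subset using (Subset; inside; outside; ⊤; _⊂_)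
  renaming (∣_∣ to ∣_∣ₛ)
import Data.Integer.Base as ℤ
import Data.Integer.Properties as ℤ
open import Data.Nat.Base as ℕ using (ℕ; zero; suc; parity)
import Data.Nat.Properties as ℕ
import Data.Nat.Solver as ℕ
open import Data.Parity.Base using (Parity; _⁻¹)
import Data.Parity.Properties as ℙ
open import Data.Product.Base using (_×_; _,_; ∃; proj₁; proj₂)
open import Data.Rational.Base
open import Data.Rational.Properties
open import Data.Rational.Solver using (module +-*-Solver)
open import Data.Rational.Unnormalised.Base as ℚᵘ using (mkℚᵘ)
import Data.Rational.Unnormalised.Properties as ℚᵘ
open import Data.Sum.Base as Sum using (_⊎_; inj₁; inj₂)
open import Data.Vec.Base using ([]; _∷_)
open import Function.Base using (_∘_)
open import Function.Bundles using (_⇔_)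
open import Level using (0ℓ)
open import Relation.Binary.Core using (Rel)
open import Relation.Binary.Definitions using (Symmetric; Irreflexive)
open import Relation.Binary.PropositionalEquality
open import Relation.Nullary using (¬_; yes; no; contradiction)

-- Real numbers are Cauchy sequences of rationals.  Two sequences denote the
-- same real number when each is ≤ℝ the other.

IsCauchy : (ℕ → ℚ) → Set
IsCauchy s = ∀ ε → 0ℚ < ε →
  ∃ λ N → ∀ m n → N ℕ.≤ m → N ℕ.≤ n → ∣ s m - s n ∣ < ε

record ℝ : Set where
  constructor mkℝ
  field
    seq      : ℕ → ℚ
    isCauchy : IsCauchy seq

open ℝ public

infix 4 _≤ℝ_

_≤ℝ_ : Rel ℝ 0ℓ
x ≤ℝ y = ∀ ε → 0ℚ < ε → ∃ λ N → ∀ n → N ℕ.≤ n → seq x n ≤ seq y n + ε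

private

  half : ∀ {ε} → 0ℚ < ε → 0ℚ < ½ * ε
  half {ε} 0<ε = positive⁻¹ _ {{pos*pos⇒pos ½ ε {{positive 0<ε}}}}

  half+half : ∀ ε → ½ * ε + ½ * ε ≡ ε
  half+half ε = trans (sym (*-distribʳ-+ ε ½ ½)) (*-identityˡ ε)

  p≤∣p∣ : ∀ p → p ≤ ∣ p ∣
  p≤∣p∣ p with ≤-total 0ℚ p
  ... | inj₁ 0≤p = ≤-reflexive (sym (0≤p⇒∣p∣≡p 0≤p))
  ... | inj₂ p≤0 = ≤-trans p≤0 (0≤∣p∣ p)

  ∣p∣<q : ∀ p {q} → p < q → - p < q → ∣ p ∣ < q
  ∣p∣<q p p<q -p<q with ∣p∣≡p∨∣p∣≡-p p
  ... | inj₁ eq = subst (_< _) (sym eq) p<q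
  ... | inj₂ eq = subst (_< _) (sym eq) -p<q

  ∣p∣≤∣p-q∣+∣q∣ : ∀ p q → ∣ p ∣ ≤ ∣ p - q ∣ + ∣ q ∣
  ∣p∣≤∣p-q∣+∣q∣ p q = subst (λ r → ∣ r ∣ ≤ ∣ p - q ∣ + ∣ q ∣)
    (solve 2 (λ p q → p :- q :+ q := p) refl p q) (∣p+q∣≤∣p∣+∣q∣ (p - q) q)
    where open +-*-Solver

  const-cauchy : ∀ q → IsCauchy (λ _ → q)
  const-cauchy q ε 0<ε = 0 , λ _ _ _ _ →
    subst (λ r → ∣ r ∣ < ε) (sym (+-inverseʳ q)) 0<ε

  +-cauchy : ∀ s t → IsCauchy s → IsCauchy t → IsCauchy (λ n → s n + t n)
  +-cauchy s t S T ε 0<ε =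
    let M , S< = S (½ * ε) (half 0<ε)
        N , T< = T (½ * ε) (half 0<ε)
    in M ℕ.⊔ N , λ m n ≤m ≤n → begin-strict
      ∣ (s m + t m) - (s n + t n) ∣ ≡⟨ cong ∣_∣ (rearrange (s m) (t m) (s n) (t n)) ⟩
      ∣ (s m - s n) + (t m - t n) ∣ ≤⟨ ∣p+q∣≤∣p∣+∣q∣ (s m - s n) (t m - t n) ⟩
      ∣ s m - s n ∣ + ∣ t m - t n ∣
        <⟨ +-mono-< (S< m n (ℕ.m⊔n≤o⇒m≤o M N ≤m) (ℕ.m⊔n≤o⇒m≤o M N ≤n))
                    (T< m n (ℕ.m⊔n≤o⇒n≤o M N ≤m) (ℕ.m⊔n≤o⇒n≤o M N ≤n)) ⟩
      ½ * ε + ½ * ε                 ≡⟨ half+half ε ⟩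
      ε                             ∎
    where
    open ≤-Reasoning
    open +-*-Solver
    rearrange : ∀ a b c d → (a + b) - (c + d) ≡ (a - c) + (b - d)
    rearrange = solve 4 (λ a b c d → (a :+ b) :- (c :+ d) := (a :- c) :+ (b :- d)) refl

  neg-cauchy : ∀ s → IsCauchy s → IsCauchy (λ n → - s n)
  neg-cauchy s S ε 0<ε =
    let N , S< = S ε 0<ε
    in N , λ m n ≤m ≤n → subst (_< ε)
      (trans (sym (∣-p∣≡∣p∣ (s m - s n))) (cong ∣_∣ (neg-distrib-+ (s m) (- s n))))
      (S< m n ≤m ≤n)

  bounded : ∀ s → IsCauchy s →
            ∃ λ B → 0ℚ < B × ∃ λ N → ∀ n → N ℕ.≤ n → ∣ s n ∣ ≤ B
  bounded s S =
    let N , S< = S 1ℚ (positive⁻¹ 1ℚ)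
    in 1ℚ + ∣ s N ∣
     , +-mono-<-≤ (positive⁻¹ 1ℚ) (0≤∣p∣ (s N))
     , N , λ n ≤n → ≤-trans (∣p∣≤∣p-q∣+∣q∣ (s n) (s N))
                            (+-monoˡ-≤ ∣ s N ∣ (<⇒≤ (S< n N ≤n ℕ.≤-refl)))

  scale : ∀ {B ε} → 0ℚ < B → 0ℚ < ε → ∃ λ δ → 0ℚ < δ × B * δ ≡ ε
  scale {B} {ε} 0<B 0<ε = 1/ B * ε
    , positive⁻¹ _ {{pos*pos⇒pos (1/ B) {{1/pos⇒pos B}} ε {{positive 0<ε}}}}
    , trans (sym (*-assoc B (1/ B) ε))
            (trans (cong (_* ε) (*-inverseʳ B)) (*-identityˡ ε))
    where
    instance
      B-pos     = positive 0<B
      B-nonZero = pos⇒nonZero B {{B-pos}}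

  ∣p*q∣<r : ∀ {p q B δ ε} → 0ℚ < B → ∣ p ∣ ≤ B → ∣ q ∣ < δ → B * δ ≡ ε → ∣ p * q ∣ < ε
  ∣p*q∣<r {p} {q} {B} {δ} {ε} 0<B p≤B q<δ eq = begin-strict
    ∣ p * q ∣     ≡⟨ ∣p*q∣≡∣p∣*∣q∣ p q ⟩
    ∣ p ∣ * ∣ q ∣ ≤⟨ *-monoʳ-≤-nonNeg ∣ q ∣ {{∣-∣-nonNeg q}} p≤B ⟩
    B * ∣ q ∣     <⟨ *-monoʳ-<-pos B {{positive 0<B}} q<δ ⟩
    B * δ         ≡⟨ eq ⟩
    ε             ∎
    where open ≤-Reasoning

  *-cauchy : ∀ s t → IsCauchy s → IsCauchy t → IsCauchy (λ n → s n * t n)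
  *-cauchy s t S T ε 0<ε =
    let A , 0<A , K , s≤A = bounded s S
        B , 0<B , L , t≤B = bounded t T
        α , 0<α , Aα≡     = scale 0<A (half 0<ε)
        β , 0<β , Bβ≡     = scale 0<B (half 0<ε)
        M , S<            = S β 0<β
        N , T<            = T α 0<α
        KL = K ℕ.⊔ L
        MN = M ℕ.⊔ N
    in KL ℕ.⊔ MN , λ m n ≤m ≤n →
      let MN≤m = ℕ.m⊔n≤o⇒n≤o KL MN ≤m
          MN≤n = ℕ.m⊔n≤o⇒n≤o KL MN ≤n
          K≤m  = ℕ.m⊔n≤o⇒m≤o K L (ℕ.m⊔n≤o⇒m≤o KL MN ≤m)
          L≤n  = ℕ.m⊔n≤o⇒n≤o K L (ℕ.m⊔n≤o⇒m≤o KL MN ≤n)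
      in begin-strict
      ∣ s m * t m - s n * t n ∣
        ≡⟨ cong ∣_∣ (rearrange (s m) (t m) (s n) (t n)) ⟩
      ∣ s m * (t m - t n) + t n * (s m - s n) ∣
        ≤⟨ ∣p+q∣≤∣p∣+∣q∣ (s m * (t m - t n)) (t n * (s m - s n)) ⟩
      ∣ s m * (t m - t n) ∣ + ∣ t n * (s m - s n) ∣
        <⟨ +-mono-<
             (∣p*q∣<r {p = s m} 0<A (s≤A m K≤m)
               (T< m n (ℕ.m⊔n≤o⇒n≤o M N MN≤m) (ℕ.m⊔n≤o⇒n≤o M N MN≤n)) Aα≡)
             (∣p*q∣<r {p = t n} 0<B (t≤B n L≤n)
               (S< m n (ℕ.m⊔n≤o⇒m≤o M N MN≤m) (ℕ.m⊔n≤o⇒m≤o M N MN≤n)) Bβ≡) ⟩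
      ½ * ε + ½ * ε
        ≡⟨ half+half ε ⟩
      ε ∎
    where
    open ≤-Reasoning
    open +-*-Solver
    rearrange : ∀ a b c d → a * b - c * d ≡ a * (b - d) + d * (a - c)
    rearrange = solve 4 (λ a b c d →
      a :* b :- c :* d := a :* (b :- d) :+ d :* (a :- c)) refl

fromℚ : ℚ → ℝ
fromℚ q = mkℝ (λ _ → q) (const-cauchy q)

1ℝ : ℝ
1ℝ = fromℚ 1ℚ

infixl 6 _+ℝ_ _-ℝ_
infixl 7 _*ℝ_
infix  8 -ℝ_

_+ℝ_ : ℝ → ℝ → ℝ
x +ℝ y = mkℝ (λ n → seq x n + seq y n) (+-cauchy (seq x) (seq y) (isCauchy x) (isCauchy y))

-ℝ_ : ℝ → ℝ
-ℝ x = mkℝ (λ n → - seq x n) (neg-cauchy (seq x) (isCauchy x))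

_-ℝ_ : ℝ → ℝ → ℝ
x -ℝ y = x +ℝ -ℝ y

_*ℝ_ : ℝ → ℝ → ℝ
x *ℝ y = mkℝ (λ n → seq x n * seq y n) (*-cauchy (seq x) (seq y) (isCauchy x) (isCauchy y))

⌊√_⌋ : ℕ → ℕ
⌊√ zero ⌋  = 0
⌊√ suc m ⌋ with suc ⌊√ m ⌋ ℕ.* suc ⌊√ m ⌋ ℕ.≤? suc m
... | yes _ = suc ⌊√ m ⌋
... | no  _ = ⌊√ m ⌋

⌊√⌋-spec : ∀ m → ⌊√ m ⌋ ℕ.* ⌊√ m ⌋ ℕ.≤ m × m ℕ.< suc ⌊√ m ⌋ ℕ.* suc ⌊√ m ⌋
⌊√⌋-spec zero = ℕ.z≤n , ℕ.s≤s ℕ.z≤n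
⌊√⌋-spec (suc m) with suc ⌊√ m ⌋ ℕ.* suc ⌊√ m ⌋ ℕ.≤? suc m | ⌊√⌋-spec m
... | yes ≤m | _  , m< = ≤m , ℕ.≤-<-trans m< (ℕ.*-mono-< (ℕ.n<1+n r) (ℕ.n<1+n r))
  where r = suc ⌊√ m ⌋
... | no  ≰m | ≤m , _  = ℕ.m≤n⇒m≤1+n ≤m , ℕ.≰⇒> ≰m

-- An approximation of √ ∣ q ∣ from below, to within 1/N for N = suc n, based on
-- √ (a/b) = √ (abN²) / (bN).
√approx : ℕ → ℚ → ℚ
√approx n q = ℤ.+ ⌊√ ℤ.∣ ↥ q ∣ ℕ.* ↧ₙ q ℕ.* (suc n ℕ.* suc n) ⌋ / (↧ₙ q ℕ.* suc n)

precision : ℕ → ℚ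
precision n = ℤ.+ 1 / suc n

√approx-nonNeg : ∀ n q → NonNegative (√approx n q)
√approx-nonNeg n q = normalize-nonNeg
  ⌊√ ℤ.∣ ↥ q ∣ ℕ.* ↧ₙ q ℕ.* (suc n ℕ.* suc n) ⌋ (↧ₙ q ℕ.* suc n)

private
  toℚᵘ-/ : ∀ a n → toℚᵘ (ℤ.+ a / suc n) ℚᵘ.≃ mkℚᵘ (ℤ.+ a) n
  toℚᵘ-/ a n = toℚᵘ-fromℚᵘ (mkℚᵘ (ℤ.+ a) n)

√approx²≤ : ∀ n q → √approx n q * √approx n q ≤ ∣ q ∣
√approx²≤ n q@(mkℚ z b-1 _) = toℚᵘ-cancel-≤ (begin
  toℚᵘ (s * s)        ≃⟨ toℚᵘ-homo-* s s ⟩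
  toℚᵘ s ℚᵘ.* toℚᵘ s  ≃⟨ ℚᵘ.*-cong (toℚᵘ-/ r _) (toℚᵘ-/ r _) ⟩
  s′ ℚᵘ.* s′          ≤⟨ ℚᵘ.*≤* (subst₂ ℤ._≤_ lhs rhs (ℤ.+≤+ r²b≤)) ⟩
  mkℚᵘ (ℤ.+ a) b-1    ∎)
  where
  open ℚᵘ.≤-Reasoning
  a  = ℤ.∣ z ∣
  b  = suc b-1
  N  = suc n
  r  = ⌊√ a ℕ.* b ℕ.* (N ℕ.* N) ⌋
  s  = √approx n q
  s′ = mkℚᵘ (ℤ.+ r) (n ℕ.+ b-1 ℕ.* suc n)

  r²b≤ : r ℕ.* r ℕ.* b ℕ.≤ a ℕ.* ((b ℕ.* N) ℕ.* (b ℕ.* N))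
  r²b≤ = ℕ.≤-trans
    (ℕ.*-monoˡ-≤ b (proj₁ (⌊√⌋-spec (a ℕ.* b ℕ.* (N ℕ.* N)))))
    (ℕ.≤-reflexive (solve 3 (λ a b N →
      a :* b :* (N :* N) :* b := a :* ((b :* N) :* (b :* N))) refl a b N))
    where open ℕ.+-*-Solver

  lhs : ℤ.+ (r ℕ.* r ℕ.* b) ≡ (ℤ.+ r ℤ.* ℤ.+ r) ℤ.* ℤ.+ b
  lhs = trans (ℤ.pos-* (r ℕ.* r) b) (cong (ℤ._* ℤ.+ b) (ℤ.pos-* r r))

  rhs : ℤ.+ (a ℕ.* ((b ℕ.* N) ℕ.* (b ℕ.* N))) ≡ ℤ.+ a ℤ.* ℤ.+ ((b ℕ.* N) ℕ.* (b ℕ.* N))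
  rhs = ℤ.pos-* a _

<[√approx+precision]² : ∀ n q →
  ∣ q ∣ < (√approx n q + precision n) * (√approx n q + precision n)
<[√approx+precision]² n q@(mkℚ z b-1 _) = toℚᵘ-cancel-< (begin-strict
  mkℚᵘ (ℤ.+ a) b-1    <⟨ ℚᵘ.*<* (subst₂ ℤ._<_ lhs rhs (ℤ.+<+ <[r+b]²b)) ⟩
  t′ ℚᵘ.* t′          ≃⟨ ℚᵘ.*-cong t≃ t≃ ⟨
  toℚᵘ t ℚᵘ.* toℚᵘ t  ≃⟨ toℚᵘ-homo-* t t ⟨
  toℚᵘ (t * t)        ∎)
  where
  open ℚᵘ.≤-Reasoning
  a  = ℤ.∣ z ∣
  b  = suc b-1
  N  = suc n
  r  = ⌊√ a ℕ.* b ℕ.* (N ℕ.* N) ⌋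
  s  = √approx n q
  t  = s + precision n
  t′ = mkℚᵘ (ℤ.+ (r ℕ.+ b)) (n ℕ.+ b-1 ℕ.* suc n)

  sum≡ : (ℤ.+ r ℤ.* ℤ.+ N ℤ.+ ℤ.+ 1 ℤ.* ℤ.+ (b ℕ.* N)) ℤ.* ℤ.+ (b ℕ.* N)
       ≡ ℤ.+ (r ℕ.+ b) ℤ.* ℤ.+ ((b ℕ.* N) ℕ.* N)
  sum≡ = trans
      (cong (ℤ._* ℤ.+ (b ℕ.* N)) (trans
        (cong₂ ℤ._+_ (sym (ℤ.pos-* r N)) (sym (ℤ.pos-* 1 (b ℕ.* N))))
        (sym (ℤ.pos-+ (r ℕ.* N) (1 ℕ.* (b ℕ.* N))))))
      (trans (sym (ℤ.pos-* (r ℕ.* N ℕ.+ 1 ℕ.* (b ℕ.* N)) (b ℕ.* N)))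
      (trans (cong ℤ.+_ (solve 3 (λ r b N →
          (r :* N :+ con 1 :* (b :* N)) :* (b :* N) := (r :+ b) :* (b :* N :* N))
          refl r b N))
        (ℤ.pos-* (r ℕ.+ b) _)))
    where open ℕ.+-*-Solver

  t≃ : toℚᵘ t ℚᵘ.≃ t′
  t≃ = ℚᵘ.≃-trans (toℚᵘ-homo-+ s (precision n))
      (ℚᵘ.≃-trans (ℚᵘ.+-cong (toℚᵘ-/ r _) (toℚᵘ-/ 1 n)) (ℚᵘ.*≡* sum≡))

  <[r+b]²b : a ℕ.* ((b ℕ.* N) ℕ.* (b ℕ.* N)) ℕ.< (r ℕ.+ b) ℕ.* (r ℕ.+ b) ℕ.* b
  <[r+b]²b = ℕ.≤-<-trans
    (ℕ.≤-reflexive (solve 3 (λ a b N →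
      a :* ((b :* N) :* (b :* N)) := a :* b :* (N :* N) :* b) refl a b N))
    (ℕ.*-monoˡ-< b (ℕ.<-≤-trans (proj₂ (⌊√⌋-spec (a ℕ.* b ℕ.* (N ℕ.* N))))
      (ℕ.*-mono-≤ suc-r≤ suc-r≤)))
    where
    open ℕ.+-*-Solver
    suc-r≤ : suc r ℕ.≤ r ℕ.+ b
    suc-r≤ = subst (ℕ._≤ r ℕ.+ b) (ℕ.+-comm r 1) (ℕ.+-monoʳ-≤ r (ℕ.s≤s ℕ.z≤n))

  lhs : ℤ.+ (a ℕ.* ((b ℕ.* N) ℕ.* (b ℕ.* N))) ≡ ℤ.+ a ℤ.* ℤ.+ ((b ℕ.* N) ℕ.* (b ℕ.* N))
  lhs = ℤ.pos-* a _

  rhs : ℤ.+ ((r ℕ.+ b) ℕ.* (r ℕ.+ b) ℕ.* b) ≡ (ℤ.+ (r ℕ.+ b) ℤ.* ℤ.+ (r ℕ.+ b)) ℤ.* ℤ.+ b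
  rhs = trans (ℤ.pos-* ((r ℕ.+ b) ℕ.* (r ℕ.+ b)) b)
              (cong (ℤ._* ℤ.+ b) (ℤ.pos-* (r ℕ.+ b) (r ℕ.+ b)))

precision-small : ∀ {ε} → 0ℚ < ε → ∃ λ N → ∀ n → N ℕ.≤ n → precision n ≤ ε
precision-small {ε@(mkℚ ℤ.+[1+ a ] d _)} 0<ε = d , λ n d≤n → toℚᵘ-cancel-≤
  (ℚᵘ.≤-respˡ-≃ (ℚᵘ.≃-sym (toℚᵘ-/ 1 n))
    (ℚᵘ.*≤* (ℤ.+≤+ (ℕ.*-mono-≤ {1} {suc a} (ℕ.s≤s ℕ.z≤n) (ℕ.s≤s d≤n)))))
precision-small {mkℚ ℤ.+0 _ _}       (*<* (ℤ.+<+ ()))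
precision-small {mkℚ ℤ.-[1+ _ ] _ _} (*<* ())

private

  √approx-close : ∀ {p q ε m n} → 0ℚ < ε → precision n ≤ ½ * ε →
    ∣ p - q ∣ < ½ * ε * (½ * ε) → √approx m p - √approx n q < ε
  √approx-close {p} {q} {ε} {m} {n} 0<ε n≤ p-q< = ≰⇒> λ ε≤s-t →
    let h≤s : t + e + h ≤ s
        h≤s = begin
          t + e + h         ≤⟨ +-monoˡ-≤ h (+-monoʳ-≤ t n≤) ⟩
          t + h + h         ≡⟨ trans (+-assoc t h h) (cong (t +_) (half+half ε)) ⟩
          t + ε             ≤⟨ +-monoʳ-≤ t ε≤s-t ⟩
          t + (s - t)       ≡⟨ solve 2 (λ s t → t :+ (s :- t) := s) refl s t ⟩
          s                 ∎
    in <-irrefl refl (begin-strict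
      h * h + ∣ q ∣                    <⟨ +-monoʳ-< (h * h) (<[√approx+precision]² n q) ⟩
      h * h + u * u                    ≡⟨ +-identityʳ (h * h + u * u) ⟨
      h * h + u * u + 0ℚ               ≤⟨ +-monoʳ-≤ (h * h + u * u) 0≤2uh ⟩
      h * h + u * u + (u * h + u * h)  ≡⟨ solve 2 (λ u h →
          h :* h :+ u :* u :+ (u :* h :+ u :* h) := (u :+ h) :* (u :+ h)) refl u h ⟩
      (u + h) * (u + h)                ≤⟨ *-monoʳ-≤-nonNeg (u + h) h≤s ⟩
      s * (u + h)                      ≤⟨ *-monoˡ-≤-nonNeg s h≤s ⟩
      s * s                            ≤⟨ √approx²≤ m p ⟩
      ∣ p ∣                            ≤⟨ ∣p∣≤∣p-q∣+∣q∣ p q ⟩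
      ∣ p - q ∣ + ∣ q ∣                ≤⟨ +-monoˡ-≤ ∣ q ∣ (<⇒≤ p-q<) ⟩
      h * h + ∣ q ∣                    ∎)
    where
    open ≤-Reasoning
    open +-*-Solver
    s = √approx m p
    t = √approx n q
    e = precision n
    h = ½ * ε
    u = t + e
    instance
      s≥0 : NonNegative s
      s≥0 = √approx-nonNeg m p
      t≥0 : NonNegative t
      t≥0 = √approx-nonNeg n q
      e≥0 : NonNegative e
      e≥0 = normalize-nonNeg 1 (suc n)
      h≥0 : NonNegative h
      h≥0 = nonNegative (<⇒≤ (half 0<ε))
      u≥0 : NonNegative u
      u≥0 = nonNeg+nonNeg⇒nonNeg t e
      u+h≥0 : NonNegative (u + h)
      u+h≥0 = nonNeg+nonNeg⇒nonNeg u h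
      uh≥0 : NonNegative (u * h)
      uh≥0 = nonNeg*nonNeg⇒nonNeg u h
    0≤2uh : 0ℚ ≤ u * h + u * h
    0≤2uh = nonNegative⁻¹ _ {{nonNeg+nonNeg⇒nonNeg (u * h) (u * h)}}

  √-cauchy : ∀ s → IsCauchy s → IsCauchy (λ n → √approx n (s n))
  √-cauchy s S ε 0<ε =
    let h       = ½ * ε
        0<h     = half 0<ε
        M , S<  = S (h * h) (positive⁻¹ _ {{pos*pos⇒pos h {{positive 0<h}} h {{positive 0<h}}}})
        N , pr≤ = precision-small 0<h
    in M ℕ.⊔ N , λ m n ≤m ≤n →
      let M≤m = ℕ.m⊔n≤o⇒m≤o M N ≤m
          M≤n = ℕ.m⊔n≤o⇒m≤o M N ≤n
          N≤m = ℕ.m⊔n≤o⇒n≤o M N ≤m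
          N≤n = ℕ.m⊔n≤o⇒n≤o M N ≤n
      in ∣p∣<q _
        (√approx-close {s m} {s n} {m = m} 0<ε (pr≤ n N≤n) (S< m n M≤m M≤n))
        (subst (_< ε) (solve 2 (λ a b → b :- a := :- (a :- b)) refl
                         (√approx m (s m)) (√approx n (s n)))
          (√approx-close {s n} {s m} {m = n} 0<ε (pr≤ m N≤m) (S< n m M≤n M≤m)))
    where open +-*-Solver

√∣_∣ : ℝ → ℝ
√∣ x ∣ = mkℝ (λ n → √approx n (seq x n)) (√-cauchy (seq x) (isCauchy x))

ℝ² : Set
ℝ² = ℝ × ℝ

dist : ℝ² → ℝ² → ℝ
dist (x , y) (x′ , y′) =
  √∣ (x -ℝ x′) *ℝ (x -ℝ x′) +ℝ (y -ℝ y′) *ℝ (y -ℝ y′) ∣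

record Graph : Set₁ where
  field
    order      : ℕ
    Adj        : Rel (Fin order) 0ℓ
    Adj-sym    : Symmetric Adj
    Adj-irrefl : Irreflexive _≡_ Adj

  Vertex : Set
  Vertex = Fin order

open Graph using (order; Adj; Vertex)

-- The increasing enumeration of the elements of a subset.
element : ∀ {n} (S : Subset n) → Fin ∣ S ∣ₛ → Fin n
element (outside ∷ S) i       = suc (element S i)
element (inside  ∷ S) zero    = zero
element (inside  ∷ S) (suc i) = suc (element S i)

induced : (G : Graph) → Subset (order G) → Graph
induced G S = record
  { order      = ∣ S ∣ₛ
  ; Adj        = λ i j → Adj G (element S i) (element S j)
  ; Adj-sym    = Graph.Adj-sym G
  ; Adj-irrefl = λ { refl → Graph.Adj-irrefl G refl }
  }

IsUDG : Graph → Set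
IsUDG G = ∃ λ (f : Vertex G → ℝ²) →
  ∀ u v → u ≢ v → Adj G u v ⇔ dist (f u) (f v) ≤ℝ 1ℝ

IsMinimalNonUDG : Graph → Set
IsMinimalNonUDG G =
  ¬ IsUDG G × (∀ (S : Subset (order G)) → S ⊂ ⊤ → IsUDG (induced G S))

record BipartiteGraph : Set₁ where
  field
    graph       : Graph
    part        : Vertex graph → Parity
    independent : ∀ {u v} → Adj graph u v → part u ≢ part v

infix 8 _⋆

_⋆ : BipartiteGraph → Graph
B ⋆ = record
  { order      = order graph
  ; Adj        = λ u v → u ≢ v × (part u ≡ part v ⊎ Adj graph u v)
  ; Adj-sym    = λ (u≢v , uv) → u≢v ∘ sym , Sum.map sym (Graph.Adj-sym graph) uv
  ; Adj-irrefl = λ u≡v (u≢v , _) → u≢v u≡v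
  }
  where open BipartiteGraph B

-- On the vertices 0, …, n - 1 in cyclic order.
Next : ∀ {n} → Rel (Fin n) 0ℓ
Next {n} i j = suc (toℕ i) ≡ toℕ j ⊎ (suc (toℕ i) ≡ n × toℕ j ≡ 0)

cycle : ∀ n → 3 ℕ.≤ n → Graph
cycle n 3≤n = record
  { order      = n
  ; Adj        = λ i j → Next i j ⊎ Next j i
  ; Adj-sym    = Sum.swap
  ; Adj-irrefl = λ { refl → Sum.[ next-irrefl , next-irrefl ] }
  }
  where
  next-irrefl : ∀ {i : Fin n} → ¬ Next i i
  next-irrefl (inj₁ eq)        = ℕ.1+n≢n eq
  next-irrefl (inj₂ (eq , i≡0)) with refl ← trans (cong suc (sym i≡0)) eq =
    contradiction 3≤n λ { (ℕ.s≤s ()) }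

evenCycle : ∀ k → 3 ℕ.≤ 2 ℕ.* k → BipartiteGraph
evenCycle k 3≤2k = record
  { graph       = cycle (2 ℕ.* k) 3≤2k
  ; part        = parity ∘ toℕ
  ; independent = Sum.[ next-parity , (λ n → next-parity n ∘ sym) ]
  }
  where
  next-parity : ∀ {i j : Fin (2 ℕ.* k)} → Next i j → parity (toℕ i) ≢ parity (toℕ j)
  next-parity {i} {j} next eq = ℙ.p≢p⁻¹ (parity (suc (toℕ i)))
    (trans (same next) (trans (sym eq) (sym (ℙ.suc-homo-⁻¹ (toℕ i)))))
    where
    same : Next i j → parity (suc (toℕ i)) ≡ parity (toℕ j)
    same (inj₁ eq)         = cong parity eq
    same (inj₂ (eq , j≡0)) = trans (cong parity eq)
      (trans (ℙ.*-homo-* 2 k) (sym (cong parity j≡0)))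

4≤k⇒3≤2k : ∀ {k} → 4 ℕ.≤ k → 3 ℕ.≤ 2 ℕ.* k
4≤k⇒3≤2k {k} 4≤k = ℕ.≤-trans (ℕ.<⇒≤ 4≤k) (ℕ.m≤m+n k (k ℕ.+ 0))

{-# OPTIONS --safe #-}
module Submission where

-- In a unit disk graph, an induced 4-cycle is drawn as a convex quadrilateral.  Two edges of the cycle
-- without an edge between them are opposite sides of such a quadrilateral in C⋆.  Hence everything far
-- from an edge lies on one side of its line, and, orienting the edges from U to W, one of two far edges
-- is to the left of the other if and only if the latter is to the right of the former.  For k ≥ 4, one
-- can move the two edges in turn, one step at a time, around the cycle until they are exchanged.  The
-- side does not change on the way, a contradiction.
-- Since non-edges are strictly longer than 1, rational approximations of the coordinates can be used
-- instead, for some R separating the squared lengths of edges and non-edges.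
-- Conversely, P⋆ for a path P is drawn with the vertices equally spaced along two parallel lines.

open import Defs
open import Data.Nat using (ℕ; _≤_; zero; suc; s≤s; z≤n; parity)
import Data.Nat as ℕ
import Data.Nat.Properties as ℕ
import Algebra.Bundles as Algebra
open import Data.Bool.Base using (Bool; not)
import Data.Bool.Properties as Bool
open import Data.Empty using (⊥; ⊥-elim)
open import Data.Fin.Base using (Fin; zero; suc; toℕ; fromℕ<)
import Data.Fin.Properties as Fin
open import Data.Fin.Subset using (Subset; _∈_; inside; outside)
import Data.Integer.Base as ℤ
open import Data.Parity.Base using (Parity; 0ℙ; 1ℙ)
import Data.Parity.Properties as ℙ
open import Data.Product.Base using (_×_; _,_; ∃; proj₁; proj₂)
open import Data.Rational.Base
  using (ℚ; 0ℚ; 1ℚ; ½; ∣_∣; _+_; _*_; _-_; -_; _/_; 1/_; nonNegative; nonPositive; positive)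
  renaming (_≤_ to _≤ℚ_; _<_ to _<ℚ_)
import Data.Rational.Properties as ℚ
open import Data.Rational.Solver using (module +-*-Solver)
open import Data.Sum.Base using (_⊎_; inj₁; inj₂; [_,_]′)
open import Data.Vec.Base using (_∷_; here; there)
open import Function.Base using (_∘_; id)
open import Function.Bundles using (_⇔_; mk⇔; Equivalence)
open import Relation.Binary.Definitions using (tri<; tri≈; tri>)
open import Relation.Binary.PropositionalEquality
open import Relation.Nullary using (¬_; yes; no; contradiction; does)
open import Relation.Nullary.Decidable using (does-⇔; ¬?)
open import Algebra.Properties.Group ℚ.+-0-group using () renaming (x∙y⁻¹≈ε⇒x≈y to p-q≡0⇒p≡q)
open import Algebra.Properties.Semiring.Mult
  (Algebra.CommutativeRing.semiring ℚ.+-*-commutativeRing)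
  using (×-homo-+; ×-assoc-*) renaming (_×_ to _·_)

-- Signs of sums and products of rationals.

infixl 6 _⊕_ _⊞_
infixl 7 _⊗_

_⊕_ : ∀ {p q} → 0ℚ ≤ℚ p → 0ℚ ≤ℚ q → 0ℚ ≤ℚ p + q
_⊕_ = ℚ.+-mono-≤

_⊞_ : ∀ {p q} → 0ℚ <ℚ p → 0ℚ ≤ℚ q → 0ℚ <ℚ p + q
_⊞_ = ℚ.+-mono-<-≤

_⊗_ : ∀ {p q} → 0ℚ ≤ℚ p → 0ℚ ≤ℚ q → 0ℚ ≤ℚ p * q
_⊗_ {p} {q} 0≤p 0≤q = ℚ.nonNegative⁻¹ _
  {{ℚ.nonNeg*nonNeg⇒nonNeg p {{nonNegative 0≤p}} q {{nonNegative 0≤q}}}}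

0<p*q : ∀ {p q} → 0ℚ <ℚ p → 0ℚ <ℚ q → 0ℚ <ℚ p * q
0<p*q {p} {q} 0<p 0<q = ℚ.positive⁻¹ _ {{ℚ.pos*pos⇒pos p {{positive 0<p}} q {{positive 0<q}}}}

0≤p*p : ∀ p → 0ℚ ≤ℚ p * p
0≤p*p p with ℚ.≤-total 0ℚ p
... | inj₁ 0≤p = 0≤p ⊗ 0≤p
... | inj₂ p≤0 = ℚ.nonNegative⁻¹ _
  {{ℚ.nonPos*nonPos⇒nonPos p {{nonPositive p≤0}} p {{nonPositive p≤0}}}}

0<p*p : ∀ {p} → p ≢ 0ℚ → 0ℚ <ℚ p * p
0<p*p {p} p≢0 with ℚ.<-cmp p 0ℚ
... | tri< p<0 _ _ = subst (0ℚ <ℚ_) (solve 1 (λ p → (:- p) :* (:- p) := p :* p) refl p)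
                       (0<p*q (ℚ.neg-antimono-< p<0) (ℚ.neg-antimono-< p<0))
  where open +-*-Solver
... | tri≈ _ p≡0 _ = contradiction p≡0 p≢0
... | tri> _ _ 0<p = 0<p*q 0<p 0<p

p≤q⇒0≤q-p : ∀ {p q} → p ≤ℚ q → 0ℚ ≤ℚ q - p
p≤q⇒0≤q-p {p} {q} p≤q = subst (_≤ℚ q - p) (ℚ.+-inverseʳ p) (ℚ.+-monoˡ-≤ (- p) p≤q)

p<q⇒0<q-p : ∀ {p q} → p <ℚ q → 0ℚ <ℚ q - p
p<q⇒0<q-p {p} {q} p<q = subst (_<ℚ q - p) (ℚ.+-inverseʳ p) (ℚ.+-monoˡ-< (- p) p<q)

-- Squared distances and orientation in the rational plane.

Point : Set
Point = ℚ × ℚ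

sq : Point → Point → ℚ
sq (x , y) (x′ , y′) = (x - x′) * (x - x′) + (y - y′) * (y - y′)

det : Point → Point → Point → ℚ
det (ax , ay) (bx , by) (cx , cy) = (bx - ax) * (cy - ay) - (by - ay) * (cx - ax)

sq-sym : ∀ P Q → sq P Q ≡ sq Q P
sq-sym (x , y) (x′ , y′) = solve 4 (λ x y x′ y′ →
  (x :- x′) :* (x :- x′) :+ (y :- y′) :* (y :- y′) :=
  (x′ :- x) :* (x′ :- x) :+ (y′ :- y) :* (y′ :- y)) refl x y x′ y′
  where open +-*-Solver

0≤sq : ∀ P Q → 0ℚ ≤ℚ sq P Q
0≤sq (x , y) (x′ , y′) = 0≤p*p (x - x′) ⊕ 0≤p*p (y - y′)

-- Quadrilaterals with short sides and long diagonals

record Quad (R : ℚ) (A B C D : Point) : Set where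
  constructor quad
  field
    AB≤R : sq A B ≤ℚ R
    BC≤R : sq B C ≤ℚ R
    CD≤R : sq C D ≤ℚ R
    DA≤R : sq D A ≤ℚ R
    R<AC : R <ℚ sq A C
    R<BD : R <ℚ sq B D

rotate : ∀ {R A B C D} → Quad R A B C D → Quad R B C D A
rotate {R} {A} {B} {C} {D} (quad ab bc cd da ac bd) =
  quad bc cd da ab bd (subst (R <ℚ_) (sq-sym A C) ac)

reverse : ∀ {R A B C D} → Quad R A B C D → Quad R D C B A
reverse {R} {A} {B} {C} {D} (quad ab bc cd da ac bd) = quad
  (subst (_≤ℚ R) (sq-sym C D) cd) (subst (_≤ℚ R) (sq-sym B C) bc)
  (subst (_≤ℚ R) (sq-sym A B) ab) (subst (_≤ℚ R) (sq-sym D A) da)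
  (subst (R <ℚ_) (sq-sym B D) bd) (subst (R <ℚ_) (sq-sym A C) ac)

-- Affine dependence of four points. The weights are parameters because their signs tell how the
-- points lie relative to each other.
record Dependency (l b c m : ℚ) (A B C D : Point) : Set where
  field
    weights : l + b + c + m ≡ 0ℚ
    xs      : l * proj₁ A + b * proj₁ B + c * proj₁ C + m * proj₁ D ≡ 0ℚ
    ys      : l * proj₂ A + b * proj₂ B + c * proj₂ C + m * proj₂ D ≡ 0ℚ

-- For an affine dependence, the weighted sum of the squared distances from X to the four points
-- does not depend on X. Both sides are its values, at X = A and at X = C.
sq-balance : ∀ {l b c m A B C D} → Dependency l b c m A B C D →
  b * sq A B + c * sq A C + m * sq D A ≡ l * sq A C + b * sq B C + m * sq C D
sq-balance {l} {b} {c} {m} {ax , ay} {bx , by} {cx , cy} {dx , dy} dep = begin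
    b * sq A B + c * sq A C + m * sq D A
  ≡⟨ solve 12 (λ l b c m ax ay bx by cx cy dx dy →
       let s = λ x y x′ y′ → (x :- x′) :* (x :- x′) :+ (y :- y′) :* (y :- y′) in
       b :* s ax ay bx by :+ c :* s ax ay cx cy :+ m :* s dx dy ax ay :=
       l :* s ax ay cx cy :+ b :* s bx by cx cy :+ m :* s cx cy dx dy
         :+ ((l :+ b :+ c :+ m) :* (ax :* ax :+ ay :* ay :- cx :* cx :- cy :* cy)
         :- (l :* ax :+ b :* bx :+ c :* cx :+ m :* dx) :* (ax :- cx :+ (ax :- cx))
         :- (l :* ay :+ b :* by :+ c :* cy :+ m :* dy) :* (ay :- cy :+ (ay :- cy))))
       refl l b c m ax ay bx by cx cy dx dy ⟩
    rhs + ((l + b + c + m) * z - (l * ax + b * bx + c * cx + m * dx) * x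
                               - (l * ay + b * by + c * cy + m * dy) * y)
  ≡⟨ cong (rhs +_) (cong₂ _-_ (cong₂ _-_ (cong (_* z) weights) (cong (_* x) xs)) (cong (_* y) ys)) ⟩
    rhs + (0ℚ * z - 0ℚ * x - 0ℚ * y)
  ≡⟨ solve 4 (λ r x y z → r :+ (con 0ℚ :* z :- con 0ℚ :* x :- con 0ℚ :* y) := r) refl rhs x y z ⟩
    rhs ∎
  where
  open ≡-Reasoning
  open +-*-Solver
  open Dependency dep
  A = ax , ay
  B = bx , by
  C = cx , cy
  D = dx , dy
  rhs = l * sq A C + b * sq B C + m * sq C D
  x = ax - cx + (ax - cx)
  y = ay - cy + (ay - cy)
  z = ax * ax + ay * ay - cx * cx - cy * cy

rotate-dep : ∀ {l b c m A B C D} → Dependency l b c m A B C D → Dependency b c m l B C D A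
rotate-dep {l} {b} {c} {m} {A} {B} {C} {D} dep = record
  { weights = trans (turn l b c m) weights
  ; xs      = trans (turn (l * proj₁ A) (b * proj₁ B) (c * proj₁ C) (m * proj₁ D)) xs
  ; ys      = trans (turn (l * proj₂ A) (b * proj₂ B) (c * proj₂ C) (m * proj₂ D)) ys
  }
  where
  open Dependency dep
  open +-*-Solver
  turn : ∀ l b c m → b + c + m + l ≡ l + b + c + m
  turn = solve 4 (λ l b c m → b :+ c :+ m :+ l := l :+ b :+ c :+ m) refl

reverse-dep : ∀ {l b c m A B C D} → Dependency l b c m A B C D → Dependency m c b l D C B A
reverse-dep {l} {b} {c} {m} {A} {B} {C} {D} dep = record
  { weights = trans (flip l b c m) weights
  ; xs      = trans (flip (l * proj₁ A) (b * proj₁ B) (c * proj₁ C) (m * proj₁ D)) xs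
  ; ys      = trans (flip (l * proj₂ A) (b * proj₂ B) (c * proj₂ C) (m * proj₂ D)) ys
  }
  where
  open Dependency dep
  open +-*-Solver
  flip : ∀ l b c m → m + c + b + l ≡ l + b + c + m
  flip = solve 4 (λ l b c m → m :+ c :+ b :+ l := l :+ b :+ c :+ m) refl

-- C is a convex combination of A, B and D, hence no farther from A than B and D are.
C-not-inside : ∀ {R l b c m A B C D} → Quad R A B C D → Dependency l b c m A B C D →
  0ℚ ≤ℚ l → 0ℚ ≤ℚ m → ¬ 0ℚ <ℚ b
C-not-inside {R} {l} {b} {c} {m} {A} {B} {C} {D} Q dep 0≤l 0≤m 0<b = ℚ.<-irrefl refl (begin-strict
    0ℚ
  <⟨ 0<p*q (0<b ⊞ (0≤l ⊕ 0≤l ⊕ 0≤m)) (p<q⇒0<q-p R<AC) ⊞ 0≤m ⊗ 0≤sq C D ⊞ 0≤b ⊗ 0≤sq B C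
       ⊞ 0≤m ⊗ p≤q⇒0≤q-p DA≤R ⊞ 0≤b ⊗ p≤q⇒0≤q-p AB≤R ⊞ (0≤l ⊕ 0≤l) ⊗ 0≤R ⟩
    (b + (l + l + m)) * (p - R) + m * s + b * g + m * (R - e) + b * (R - r) + (l + l) * R
  -- `R` cancels, and the multiple `p` of the total weight removes `c`, so only terms of known sign
  -- remain on the left.
  ≡⟨ solve 10 (λ l b c m e g p r s R →
       (b :+ (l :+ l :+ m)) :* (p :- R) :+ m :* s :+ b :* g
         :+ m :* (R :- e) :+ b :* (R :- r) :+ (l :+ l) :* R :=
       (l :+ b :+ c :+ m) :* p :+ (l :* p :+ b :* g :+ m :* s :- (b :* r :+ c :* p :+ m :* e)))
       refl l b c m e g p r s R ⟩
    (l + b + c + m) * p + (l * p + b * g + m * s - (b * r + c * p + m * e))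
  ≡⟨ cong₂ (λ w z → w * p + (l * p + b * g + m * s - z)) (Dependency.weights dep) (sq-balance dep) ⟩
    0ℚ * p + (l * p + b * g + m * s - (l * p + b * g + m * s))
  ≡⟨ solve 2 (λ p z → con 0ℚ :* p :+ (z :- z) := con 0ℚ) refl p (l * p + b * g + m * s) ⟩
    0ℚ ∎)
  where
  open ℚ.≤-Reasoning
  open +-*-Solver
  open Quad Q
  e = sq D A
  g = sq B C
  p = sq A C
  r = sq A B
  s = sq C D
  0≤b = ℚ.<⇒≤ 0<b
  0≤R = ℚ.≤-trans (0≤sq A B) AB≤R

-- The segments AD and BC cross; this is the quadratic counterpart of AC + BD ≤ AD + BC.
not-crossing : ∀ {R l b c m A B C D} → Quad R A B C D → Dependency l b c m A B C D →
  0ℚ ≤ℚ l → 0ℚ ≤ℚ m → 0ℚ <ℚ l ⊎ 0ℚ <ℚ m → b ≤ℚ 0ℚ → ¬ c ≤ℚ 0ℚ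
not-crossing {R} {l} {b} {c} {m} {A} {B} {C} {D} Q dep 0≤l 0≤m 0<l∨m b≤0 c≤0 = ℚ.<-irrefl refl (begin-strict
    0ℚ
  <⟨ 0<lP+mQ 0<l∨m ⊞ 0≤-c ⊗ 0≤P ⊞ 0≤-b ⊗ 0≤Q ⊞ 0≤m ⊗ 0≤sq C D ⊞ 0≤-b ⊗ 0≤sq A B
       ⊞ 0≤l ⊗ 0≤sq A B ⊞ 0≤-c ⊗ 0≤sq C D
       ⊞ (0≤m ⊕ 0≤l) ⊗ p≤q⇒0≤q-p DA≤R ⊞ (0≤-b ⊕ 0≤-c) ⊗ p≤q⇒0≤q-p BC≤R ⟩
    l * (p - R) + m * (q - R) + - c * (p - R) + - b * (q - R) + m * s + - b * r + l * r + - c * s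
      + (m + l) * (R - e) + (- b + - c) * (R - g)
  -- The two brackets are the balance between A and C and the one between B and D; `R` cancels
  -- again.
  ≡⟨ solve 11 (λ l b c m e g p q r s R →
       l :* (p :- R) :+ m :* (q :- R) :+ (:- c) :* (p :- R) :+ (:- b) :* (q :- R)
         :+ m :* s :+ (:- b) :* r :+ l :* r :+ (:- c) :* s
         :+ (m :+ l) :* (R :- e) :+ (:- b :+ :- c) :* (R :- g) :=
       (l :* p :+ b :* g :+ m :* s :- (b :* r :+ c :* p :+ m :* e))
         :+ (c :* g :+ m :* q :+ l :* r :- (b :* q :+ c :* s :+ l :* e)))
       refl l b c m e g p q r s R ⟩
    (l * p + b * g + m * s - (b * r + c * p + m * e)) + (c * g + m * q + l * r - (b * q + c * s + l * e))
  ≡⟨ cong₂ (λ y z → (l * p + b * g + m * s - y) + (z - (b * q + c * s + l * e)))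
       (sq-balance dep) (sq-balance (rotate-dep dep)) ⟩
    (l * p + b * g + m * s - (l * p + b * g + m * s)) + (b * q + c * s + l * e - (b * q + c * s + l * e))
  ≡⟨ solve 2 (λ y z → (y :- y) :+ (z :- z) := con 0ℚ) refl
       (l * p + b * g + m * s) (b * q + c * s + l * e) ⟩
    0ℚ ∎)
  where
  open ℚ.≤-Reasoning
  open +-*-Solver
  open Quad Q
  e = sq D A
  g = sq B C
  p = sq A C
  q = sq B D
  r = sq A B
  s = sq C D
  0≤-b = ℚ.neg-antimono-≤ b≤0
  0≤-c = ℚ.neg-antimono-≤ c≤0
  0<P = p<q⇒0<q-p R<AC
  0<Q = p<q⇒0<q-p R<BD
  0≤P = ℚ.<⇒≤ 0<P
  0≤Q = ℚ.<⇒≤ 0<Q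
  0<lP+mQ : 0ℚ <ℚ l ⊎ 0ℚ <ℚ m → 0ℚ <ℚ l * (p - R) + m * (q - R)
  0<lP+mQ (inj₁ 0<l) = 0<p*q 0<l 0<P ⊞ 0≤m ⊗ 0≤Q
  0<lP+mQ (inj₂ 0<m) = ℚ.+-mono-≤-< (0≤l ⊗ 0≤P) (0<p*q 0<m 0<Q)

-- The signs of `b` and `c` leave three configurations: C in the triangle ABD, B in the triangle
-- ACD, or AD meeting BC. Reversing the quadrilateral reduces the second to the first.
no-dependency : ∀ {R l b c m A B C D} → Quad R A B C D → Dependency l b c m A B C D →
  0ℚ ≤ℚ l → 0ℚ ≤ℚ m → ¬ (0ℚ <ℚ l ⊎ 0ℚ <ℚ m)
no-dependency {b = b} {c} Q dep 0≤l 0≤m 0<l∨m with b ℚ.≤? 0ℚ | c ℚ.≤? 0ℚ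
... | no  b≰0 | _       = C-not-inside Q dep 0≤l 0≤m (ℚ.≰⇒> b≰0)
... | yes _   | no c≰0  = C-not-inside (reverse Q) (reverse-dep dep) 0≤m 0≤l (ℚ.≰⇒> c≰0)
... | yes b≤0 | yes c≤0 = not-crossing Q dep 0≤l 0≤m 0<l∨m b≤0 c≤0

-- If B and C coincided, the long diagonal BD would be the short side CD. This keeps a positive
-- weight positive when it is multiplied by `sq B C`.
0<BC : ∀ {R A B C D} → Quad R A B C D → 0ℚ <ℚ sq B C
0<BC {R} {A} {B@(bx , by)} {C@(cx , cy)} {D} Q with bx - cx ℚ.≟ 0ℚ | by - cy ℚ.≟ 0ℚ
... | no x≢0  | _       = 0<p*p x≢0 ⊞ 0≤p*p (by - cy)
... | yes _   | no y≢0  = ℚ.+-mono-≤-< (0≤p*p (bx - cx)) (0<p*p y≢0)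
... | yes x≡0 | yes y≡0 = contradiction
  (ℚ.<-≤-trans (subst (λ P → R <ℚ sq P D) B≡C R<BD) CD≤R)
  (ℚ.<-irrefl refl)
  where
  open Quad Q
  B≡C : B ≡ C
  B≡C = cong₂ _,_ (p-q≡0⇒p≡q bx cx x≡0) (p-q≡0⇒p≡q by cy y≡0)

-- The point l A + m D lies on the line BC, by l det(B,C,A) + m det(B,C,D) = 0, so it can be written
-- with B and C; multiplying by sq B C clears the denominator of its coordinate.
dependency : ∀ l m A B C D → l * det A B C + m * det B C D ≡ 0ℚ →
  let k = l * ((proj₁ A - proj₁ B) * (proj₁ C - proj₁ B) + (proj₂ A - proj₂ B) * (proj₂ C - proj₂ B))
        + m * ((proj₁ D - proj₁ B) * (proj₁ C - proj₁ B) + (proj₂ D - proj₂ B) * (proj₂ C - proj₂ B))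
      l′ = l * sq B C
      m′ = m * sq B C
  in Dependency l′ (k - l′ - m′) (- k) m′ A B C D
dependency l m A@(ax , ay) B@(bx , by) C@(cx , cy) D@(dx , dy) eq = record
  { weights = solve 3 (λ l m k → l :+ (k :- l :- m) :+ (:- k) :+ m := con 0ℚ) refl
                (l * sq B C) (m * sq B C) _
  ; xs = trans (coordinate l m ax ay bx by cx cy dx dy) (vanish (by - cy))
  -- This is `coordinate` with the axes exchanged, which negates `det`; the commutations restore the
  -- order of the summands.
  ; ys = trans (cong₂ (λ w k → l * w * ay + (k - l * w - m * w) * by + - k * cy + m * w * dy)
            (ℚ.+-comm ((bx - cx) * (bx - cx)) _)
            (cong₂ (λ u v → l * u + m * v) (ℚ.+-comm ((ax - bx) * (cx - bx)) _)
                                           (ℚ.+-comm ((dx - bx) * (cx - bx)) _)))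
          (trans (coordinate l m ay ax by bx cy cx dy dx)
          (trans (solve 10 (λ l m ax ay bx by cx cy dx dy →
            let o = λ ax ay bx by cx cy → (bx :- ax) :* (cy :- ay) :- (by :- ay) :* (cx :- ax) in
            (bx :- cx) :* (l :* o ay ax by bx cy cx :+ m :* o by bx cy cx dy dx) :=
            (cx :- bx) :* (l :* o ax ay bx by cx cy :+ m :* o bx by cx cy dx dy))
            refl l m ax ay bx by cx cy dx dy)
          (vanish (cx - bx))))
  }
  where
  open +-*-Solver
  vanish : ∀ z → z * (l * det A B C + m * det B C D) ≡ 0ℚ
  vanish z = trans (cong (z *_) eq) (ℚ.*-zeroʳ z)
  coordinate : ∀ l m ax ay bx by cx cy dx dy →
    let w = (bx - cx) * (bx - cx) + (by - cy) * (by - cy)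
        k = l * ((ax - bx) * (cx - bx) + (ay - by) * (cy - by))
          + m * ((dx - bx) * (cx - bx) + (dy - by) * (cy - by))
    in l * w * ax + (k - l * w - m * w) * bx + - k * cx + m * w * dx
     ≡ (by - cy) * (l * det (ax , ay) (bx , by) (cx , cy) + m * det (bx , by) (cx , cy) (dx , dy))
  coordinate = solve 10 (λ l m ax ay bx by cx cy dx dy →
    let w = (bx :- cx) :* (bx :- cx) :+ (by :- cy) :* (by :- cy)
        k = l :* ((ax :- bx) :* (cx :- bx) :+ (ay :- by) :* (cy :- by))
          :+ m :* ((dx :- bx) :* (cx :- bx) :+ (dy :- by) :* (cy :- by))
        o = λ ax ay bx by cx cy → (bx :- ax) :* (cy :- ay) :- (by :- ay) :* (cx :- ax)
    in l :* w :* ax :+ (k :- l :* w :- m :* w) :* bx :+ (:- k) :* cx :+ m :* w :* dx :=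
       (by :- cy) :* (l :* o ax ay bx by cx cy :+ m :* o bx by cx cy dx dy)) refl

-- Such an equation would put A and D weakly on opposite sides of the line BC. Arbitrary weights
-- cover the collinear case too.
not-opposite : ∀ {R A B C D} → Quad R A B C D → ∀ l m → 0ℚ ≤ℚ l → 0ℚ ≤ℚ m → 0ℚ <ℚ l ⊎ 0ℚ <ℚ m →
  l * det A B C + m * det B C D ≢ 0ℚ
not-opposite {A = A} {B} {C} {D} Q l m 0≤l 0≤m 0<l∨m eq =
  no-dependency Q (dependency l m A B C D eq) (0≤l ⊗ 0≤w) (0≤m ⊗ 0≤w) (0<lw∨mw 0<l∨m)
  where
  0≤w = 0≤sq B C
  0<lw∨mw : 0ℚ <ℚ l ⊎ 0ℚ <ℚ m → 0ℚ <ℚ l * sq B C ⊎ 0ℚ <ℚ m * sq B C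
  0<lw∨mw (inj₁ 0<l) = inj₁ (0<p*q 0<l (0<BC Q))
  0<lw∨mw (inj₂ 0<m) = inj₂ (0<p*q 0<m (0<BC Q))

det≢0 : ∀ {R A B C D} → Quad R A B C D → det A B C ≢ 0ℚ
det≢0 {A = A} {B} {C} {D} Q eq =
  not-opposite Q 1ℚ 0ℚ (ℚ.<⇒≤ (ℚ.positive⁻¹ 1ℚ)) ℚ.≤-refl (inj₁ (ℚ.positive⁻¹ 1ℚ))
    (trans (cong (λ u → 1ℚ * u + 0ℚ * det B C D) eq)
           (solve 1 (λ v → con 1ℚ :* con 0ℚ :+ con 0ℚ :* v := con 0ℚ) refl (det B C D)))
  where open +-*-Solver

det-pos : ∀ {R A B C D} → Quad R A B C D → 0ℚ <ℚ det A B C → 0ℚ <ℚ det B C D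
det-pos {A = A} {B} {C} {D} Q 0<u = ℚ.≰⇒> λ v≤0 →
  -- The weights cancel the two determinants against each other.
  not-opposite Q (- det B C D) (det A B C) (ℚ.neg-antimono-≤ v≤0) (ℚ.<⇒≤ 0<u) (inj₂ 0<u)
    (solve 2 (λ u v → (:- v) :* u :+ u :* v := con 0ℚ) refl (det A B C) (det B C D))
  where open +-*-Solver

-- Orientation along the cycle

-- Zero counts as not positive, so negation flips the value only for nonzero arguments; `det≢0`
-- supplies these.
sign : ℚ → Bool
sign p = does (0ℚ ℚ.<? p)

sign-neg : ∀ {p} → p ≢ 0ℚ → sign (- p) ≡ not (sign p)
sign-neg {p} p≢0 = does-⇔ (mk⇔ to from) (0ℚ ℚ.<? - p) (¬? (0ℚ ℚ.<? p))
  where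
  to : 0ℚ <ℚ - p → ¬ 0ℚ <ℚ p
  to 0<-p 0<p = ℚ.<-asym 0<-p (ℚ.neg-antimono-< 0<p)
  from : ¬ 0ℚ <ℚ p → 0ℚ <ℚ - p
  from 0≮p with ℚ.<-cmp p 0ℚ
  ... | tri< p<0 _ _ = ℚ.neg-antimono-< p<0
  ... | tri≈ _ p≡0 _ = contradiction p≡0 p≢0
  ... | tri> _ _ 0<p = contradiction 0<p 0≮p

sign-det : ∀ {R A B C D} → Quad R A B C D → sign (det A B C) ≡ sign (det B C D)
sign-det {A = A} {B} {C} {D} Q = does-⇔ (mk⇔ (det-pos Q)
  -- Three further turns lead from BCD back to ABC, which gives the converse.
  (det-pos (rotate (rotate (rotate Q))) ∘ det-pos (rotate (rotate Q)) ∘ det-pos (rotate Q)))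
  (0ℚ ℚ.<? det A B C) (0ℚ ℚ.<? det B C D)

det-rotate : ∀ A B C → det A B C ≡ det B C A
det-rotate (ax , ay) (bx , by) (cx , cy) = solve 6 (λ ax ay bx by cx cy →
  let o = λ ax ay bx by cx cy → (bx :- ax) :* (cy :- ay) :- (by :- ay) :* (cx :- ax)
  in o ax ay bx by cx cy := o bx by cx cy ax ay) refl ax ay bx by cx cy
  where open +-*-Solver

det-swap : ∀ A B C → det B A C ≡ - det A B C
det-swap (ax , ay) (bx , by) (cx , cy) = solve 6 (λ ax ay bx by cx cy →
  let o = λ ax ay bx by cx cy → (bx :- ax) :* (cy :- ay) :- (by :- ay) :* (cx :- ax)
  in o bx by ax ay cx cy := :- o ax ay bx by cx cy) refl ax ay bx by cx cy
  where open +-*-Solver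

sign-swap : ∀ A B C → det B A C ≢ 0ℚ → sign (det B A C) ≡ not (sign (det A B C))
sign-swap A B C ≢0 = trans (cong sign (det-swap A B C))
  (sign-neg λ ≡0 → ≢0 (trans (det-swap A B C) (cong -_ ≡0)))

-- For the lines AD and BC: f is not when the quadrilateral is ABCD, and id when it is ACBD.
record Facing (f : Bool → Bool) (A D B C : Point) : Set where
  constructor facing
  field
    near : sign (det A D B) ≡ sign (det A D C)
    far  : sign (det B C A) ≡ sign (det B C D)
    both : sign (det B C A) ≡ f (sign (det A D B))

-- All four consecutive turns of the quadrilateral have one sign; the rest is permuting the
-- arguments of `det`.
quad-facing : ∀ {R A B C D} → Quad R A B C D → Facing not A D B C
quad-facing {A = A} {B} {C} {D} Q = facing
  (Bool.not-injective (trans (sym q₄) (trans (sym (sign-det Q₃)) q₃)))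
  (trans (sym q₁) (sign-det Q))
  (trans (sym q₁) (trans (sign-det Q) (trans (sign-det Q₂) (trans (sign-det Q₃) q₄))))
  where
  Q₂ = rotate Q
  Q₃ = rotate Q₂
  Q₄ = rotate Q₃
  q₁ : sign (det A B C) ≡ sign (det B C A)
  q₁ = cong sign (det-rotate A B C)
  q₃ : sign (det C D A) ≡ not (sign (det A D C))
  q₃ = trans (cong sign (det-rotate C D A))
         (sign-swap A D C (det≢0 Q₃ ∘ trans (det-rotate C D A)))
  q₄ : sign (det D A B) ≡ not (sign (det A D B))
  q₄ = sign-swap A D B (det≢0 Q₄)

-- Reversing the direction of the line BC flips both of its signs, which turns `not` into `id`.
swapped-facing : ∀ {R A B C D} → Quad R A C B D → Facing id A D B C
swapped-facing {A = A} {B} {C} {D} Q = facing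
  (sym near)
  (Bool.not-injective (trans (sym swapA) (trans far swapD)))
  (trans (Bool.not-injective (trans (sym swapA) both)) near)
  where
  open Facing (quad-facing Q)
  swapA : sign (det C B A) ≡ not (sign (det B C A))
  swapA = sign-swap B C A (det≢0 Q ∘ trans (det-rotate A C B))
  swapD : sign (det C B D) ≡ not (sign (det B C D))
  swapD = sign-swap B C D (det≢0 (rotate Q))

-- Once around the cycle: the indices run over 0, …, n, and p n is the starting point again.
record CyclePoints (R : ℚ) (n : ℕ) (p : ℕ → Point) : Set where
  field
    closed  : p n ≡ p 0
    similar : ∀ {i j} → i ℕ.< j → j ≤ n → j ℕ.< i ℕ.+ n → parity i ≡ parity j → sq (p i) (p j) ≤ℚ R
    next    : ∀ {i} → i ℕ.< n → sq (p i) (p (suc i)) ≤ℚ R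
    -- The last inequation excludes the adjacencies across the end: the pairs 0, n - 1 and 1, n.
    apart   : ∀ {i j} → i ℕ.< j → j ≤ n → parity i ≢ parity j → suc i ≢ j → suc j ≢ i ℕ.+ n →
              R <ℚ sq (p i) (p j)

-- Moving two edges around the cycle.

module _ {R n p} (8≤n : 8 ≤ n) (P : CyclePoints R n p) where
  open CyclePoints P

  side : ℕ → ℕ → Bool
  side i j = sign (det (p i) (p (suc i)) (p j))

  -- On either way round, some vertex lies strictly between the edges starting at `i` and `j`, so no
  -- edge of the cycle joins them. The bound on `j` keeps `suc j` within the range 0, ..., n.
  Far : ℕ → ℕ → Set
  Far i j = 3 ℕ.+ i ≤ j × 3 ℕ.+ j ≤ i ℕ.+ n × j ℕ.< n

  suc-parity : ∀ {i j} → parity i ≡ parity j → parity (suc i) ≡ parity (suc j)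
  suc-parity {i} {j} eq = ℙ.⁻¹-injective
    (trans (ℙ.suc-homo-⁻¹ i) (trans eq (sym (ℙ.suc-homo-⁻¹ j))))

  parity≢suc : ∀ i → parity i ≢ parity (suc i)
  parity≢suc i eq = ℙ.p≢p⁻¹ (parity (suc i)) (trans (sym eq) (sym (ℙ.suc-homo-⁻¹ i)))

  -- With `p i` and `p j` in one part, the 4-cycle is i, j, j + 1, i + 1; its opposite sides i, i +
  -- 1 and j, j + 1 point the same way.
  even-facing : ∀ {i j} → Far i j → parity i ≡ parity j →
                Facing not (p i) (p (suc i)) (p j) (p (suc j))
  even-facing {i} {j} (3+i≤j , 3+j≤i+n , j<n) eq = quad-facing record
    { AB≤R = similar i<j (ℕ.<⇒≤ j<n) (ℕ.≤-trans (ℕ.m≤n+m (suc j) 2) 3+j≤i+n) eq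
    ; BC≤R = next j<n
    ; CD≤R = subst (_≤ℚ R) (sq-sym (p (suc i)) (p (suc j)))
        (similar (s≤s i<j) j<n (s≤s (ℕ.≤-trans (ℕ.m≤n+m (suc j) 2) 3+j≤i+n)) (suc-parity {i} {j} eq))
    ; DA≤R = subst (_≤ℚ R) (sq-sym (p i) (p (suc i))) (next (ℕ.<-trans i<j j<n))
    ; R<AC = apart (ℕ.m<n⇒m<1+n i<j) j<n (λ eq′ → parity≢suc j (trans (sym eq) eq′))
        (λ { refl → ℕ.<-irrefl refl i<j }) (λ eq′ → ℕ.<-irrefl eq′ 3+j≤i+n)
    ; R<BD = subst (R <ℚ_) (sq-sym (p (suc i)) (p j))
        (apart (ℕ.≤-trans (ℕ.m≤n+m (2 ℕ.+ i) 1) 3+i≤j) (ℕ.<⇒≤ j<n)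
          (λ eq′ → parity≢suc i (trans eq (sym eq′)))
          (λ { refl → ℕ.<-irrefl refl 3+i≤j })
          (λ eq′ → ℕ.<-irrefl (ℕ.suc-injective eq′) (ℕ.≤-trans (ℕ.m≤n+m (suc j) 2) 3+j≤i+n)))
    }
    where
    i<j : i ℕ.< j
    i<j = ℕ.≤-trans (ℕ.m≤n+m (suc i) 2) 3+i≤j

  -- Now `p i` and `p (suc j)` share a part, and the 4-cycle is i, j + 1, j, i + 1; the two edges
  -- point in opposite ways along it.
  odd-facing : ∀ {i j} → Far i j → parity (suc i) ≡ parity j →
               Facing id (p i) (p (suc i)) (p j) (p (suc j))
  odd-facing {i} {j} (3+i≤j , 3+j≤i+n , j<n) eq = swapped-facing record
    { AB≤R = similar (ℕ.m<n⇒m<1+n i<j) j<n (ℕ.≤-trans (ℕ.n≤1+n (2 ℕ.+ j)) 3+j≤i+n)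
        (suc-parity {suc i} {j} eq)
    ; BC≤R = subst (_≤ℚ R) (sq-sym (p j) (p (suc j))) (next j<n)
    ; CD≤R = subst (_≤ℚ R) (sq-sym (p (suc i)) (p j))
        (similar 1+i<j (ℕ.<⇒≤ j<n) (ℕ.≤-trans (ℕ.m≤n+m (suc j) 3) (s≤s 3+j≤i+n)) eq)
    ; DA≤R = subst (_≤ℚ R) (sq-sym (p i) (p (suc i))) (next (ℕ.<-trans i<j j<n))
    ; R<AC = apart i<j (ℕ.<⇒≤ j<n) (λ eq′ → parity≢suc i (trans eq′ (sym eq)))
        (λ { refl → ℕ.<-irrefl refl 1+i<j })
        (λ eq′ → ℕ.<-irrefl eq′ (ℕ.≤-trans (ℕ.n≤1+n (2 ℕ.+ j)) 3+j≤i+n))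
    ; R<BD = subst (R <ℚ_) (sq-sym (p (suc i)) (p (suc j)))
        (apart (s≤s i<j) j<n (λ eq′ → parity≢suc j (trans (sym eq) eq′))
          (λ { refl → ℕ.<-irrefl refl 1+i<j })
          (λ eq′ → ℕ.<-irrefl (ℕ.suc-injective eq′) (ℕ.≤-trans (ℕ.n≤1+n (2 ℕ.+ j)) 3+j≤i+n)))
    }
    where
    1+i<j : suc i ℕ.< j
    1+i<j = ℕ.≤-trans (ℕ.n≤1+n (2 ℕ.+ i)) 3+i≤j
    i<j : i ℕ.< j
    i<j = ℕ.<-trans (ℕ.n<1+n i) 1+i<j

  parity-cases : ∀ i j → parity i ≡ parity j ⊎ parity (suc i) ≡ parity j
  parity-cases i j with parity i | parity (suc i) | parity j | parity≢suc i
  ... | 0ℙ | 0ℙ | _  | i≢1+i = contradiction refl i≢1+i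
  ... | 0ℙ | 1ℙ | 0ℙ | _     = inj₁ refl
  ... | 0ℙ | 1ℙ | 1ℙ | _     = inj₂ refl
  ... | 1ℙ | 0ℙ | 0ℙ | _     = inj₂ refl
  ... | 1ℙ | 0ℙ | 1ℙ | _     = inj₁ refl
  ... | 1ℙ | 1ℙ | _  | i≢1+i = contradiction refl i≢1+i

  side-next : ∀ {i j} → Far i j → side i j ≡ side i (suc j)
  side-next {i} {j} ij with parity-cases i j
  ... | inj₁ even = Facing.near (even-facing ij even)
  ... | inj₂ odd  = Facing.near (odd-facing ij odd)

  -- The edge at i + 3 moves first, then the edge at i follows. Of the pairs passed, only the middle
  -- one, with difference 4, has equal parities and contributes a `not`; for it to be far, n must be
  -- at least 7.
  side-suc : ∀ i → i ≤ 2 → side (suc i) (4 ℕ.+ i) ≡ not (side i (3 ℕ.+ i))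
  side-suc i i≤2 = begin
    side (suc i) (4 ℕ.+ i)     ≡⟨ Facing.both (odd-facing far₃′ refl) ⟨
    side (4 ℕ.+ i) (suc i)     ≡⟨ Facing.far (even-facing far₄ refl) ⟨
    side (4 ℕ.+ i) i           ≡⟨ Facing.both (even-facing far₄ refl) ⟩
    not (side i (4 ℕ.+ i))     ≡⟨ cong not (side-next far₃) ⟨
    not (side i (3 ℕ.+ i))     ∎
    where
    open ≡-Reasoning
    8+i≤i+n : 8 ℕ.+ i ≤ i ℕ.+ n
    8+i≤i+n = subst (_≤ i ℕ.+ n) (ℕ.+-comm i 8) (ℕ.+-monoʳ-≤ i 8≤n)
    4+i<n : 4 ℕ.+ i ℕ.< n
    4+i<n = ℕ.≤-trans (ℕ.+-monoʳ-≤ 5 i≤2) (ℕ.≤-trans (ℕ.n≤1+n 7) 8≤n)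
    far₃ : Far i (3 ℕ.+ i)
    far₃ = ℕ.≤-refl , ℕ.≤-trans (ℕ.m≤n+m (6 ℕ.+ i) 2) 8+i≤i+n , ℕ.≤-trans (ℕ.n≤1+n (4 ℕ.+ i)) 4+i<n
    far₄ : Far i (4 ℕ.+ i)
    far₄ = ℕ.n≤1+n (3 ℕ.+ i) , ℕ.≤-trans (ℕ.n≤1+n (7 ℕ.+ i)) 8+i≤i+n , 4+i<n
    far₃′ : Far (suc i) (4 ℕ.+ i)
    far₃′ = ℕ.≤-refl , ℕ.≤-trans (ℕ.m≤n+m (7 ℕ.+ i) 2) (s≤s 8+i≤i+n) , 4+i<n

  -- The edge at 3 stays fixed while the other one moves on towards the point n, which is the point
  -- 0 again.
  side-walk : ∀ d → 6 ℕ.+ d ≤ n → side 3 6 ≡ side 3 (6 ℕ.+ d)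
  side-walk zero    _   = refl
  side-walk (suc d) d<n = trans (side-walk d (ℕ.<⇒≤ 6+d<n)) (trans
    (side-next (ℕ.m≤m+n 6 d , ℕ.+-monoʳ-≤ 3 (ℕ.<⇒≤ 6+d<n) , 6+d<n))
    (cong (side 3) (sym (ℕ.+-suc 6 d))))
    where
    6+d<n : 6 ℕ.+ d ℕ.< n
    6+d<n = subst (_≤ n) (ℕ.+-suc 6 d) d<n

  no-cycle : ⊥
  no-cycle = Bool.not-¬ (refl {x = side 0 3}) (begin
    -- The indices 0 and 3 differ in parity, so exchanging the edges causes no negation.
    side 0 3              ≡⟨ Facing.both (odd-facing far₀ refl) ⟨
    side 3 0              ≡⟨ cong (sign ∘ det (p 3) (p 4)) closed ⟨
    side 3 n              ≡⟨ cong (side 3) (ℕ.m+[n∸m]≡n 6≤n) ⟨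
    side 3 (6 ℕ.+ (n ℕ.∸ 6)) ≡⟨ side-walk (n ℕ.∸ 6) (ℕ.≤-reflexive (ℕ.m+[n∸m]≡n 6≤n)) ⟨
    -- Three joint steps from 0, 3 to 3, 6 cause three negations, an odd number.
    side 3 6              ≡⟨ side-suc 2 ℕ.≤-refl ⟩
    not (side 2 5)        ≡⟨ cong not (side-suc 1 (s≤s z≤n)) ⟩
    not (not (side 1 4))  ≡⟨ Bool.not-involutive (side 1 4) ⟩
    side 1 4              ≡⟨ side-suc 0 z≤n ⟩
    not (side 0 3)        ∎)
    where
    open ≡-Reasoning
    6≤n : 6 ≤ n
    6≤n = ℕ.≤-trans (ℕ.m≤n+m 6 2) 8≤n
    far₀ : Far 0 3
    far₀ = ℕ.≤-refl , 6≤n , ℕ.≤-trans (ℕ.m≤n+m 4 4) 8≤n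

-- Rational approximation

-- Finitely many bounds are combined by their maximum. Bounds are available only up to double
-- negation, which suffices for deriving a contradiction.
¬¬-uniform : ∀ {n} (P : Fin n → ℕ → Set) → (∀ i {M N} → M ≤ N → P i M → P i N) →
  (∀ i → ¬ ¬ ∃ (P i)) → ¬ ¬ ∃ λ N → ∀ i → P i N
¬¬-uniform {zero}  P mono ex k = k (0 , λ ())
¬¬-uniform {suc n} P mono ex k = ex zero λ (M , p) →
  ¬¬-uniform (P ∘ suc) (mono ∘ suc) (ex ∘ suc) λ (N , ps) →
  k (M ℕ.⊔ N , λ { zero → mono zero (ℕ.m≤m⊔n M N) p ; (suc i) → mono (suc i) (ℕ.m≤n⊔m M N) (ps i) })

¬¬-uniform₂ : ∀ {n} (P : Fin n → Fin n → ℕ → Set) → (∀ i j {M N} → M ≤ N → P i j M → P i j N) →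
  (∀ i j → ¬ ¬ ∃ (P i j)) → ¬ ¬ ∃ λ N → ∀ i j → P i j N
¬¬-uniform₂ P mono ex = ¬¬-uniform (λ i N → ∀ j → P i j N) (λ i M≤N p j → mono i j M≤N (p j))
  (λ i → ¬¬-uniform (P i) (mono i) (ex i))

0<½*p : ∀ {p} → 0ℚ <ℚ p → 0ℚ <ℚ ½ * p
0<½*p = 0<p*q (ℚ.positive⁻¹ ½)

½+½ : ∀ p → ½ * p + ½ * p ≡ p
½+½ p = trans (sym (ℚ.*-distribʳ-+ p ½ ½)) (ℚ.*-identityˡ p)

p≤∣p∣ : ∀ p → p ≤ℚ ∣ p ∣
p≤∣p∣ p with ℚ.≤-total 0ℚ p
... | inj₁ 0≤p = ℚ.≤-reflexive (sym (ℚ.0≤p⇒∣p∣≡p 0≤p))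
... | inj₂ p≤0 = ℚ.≤-trans p≤0 (ℚ.0≤∣p∣ p)

p*p≤q*q : ∀ {p q} → 0ℚ ≤ℚ p → p ≤ℚ q → p * p ≤ℚ q * q
p*p≤q*q {p} {q} 0≤p p≤q = ℚ.≤-trans (ℚ.*-monoˡ-≤-nonNeg p {{nonNegative 0≤p}} p≤q)
  (ℚ.*-monoʳ-≤-nonNeg q {{nonNegative (ℚ.≤-trans 0≤p p≤q)}} p≤q)

p*p<q*q : ∀ {p q} → 0ℚ <ℚ p → p <ℚ q → p * p <ℚ q * q
p*p<q*q {p} {q} 0<p p<q = ℚ.<-trans (ℚ.*-monoʳ-<-pos p {{positive 0<p}} p<q)
  (ℚ.*-monoˡ-<-pos q {{positive (ℚ.<-trans 0<p p<q)}} p<q)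

0<precision : ∀ n → 0ℚ <ℚ precision n
0<precision n = ℚ.positive⁻¹ _ {{ℚ.normalize-pos 1 (suc n)}}

√approx-upper : ∀ n {q r} → 0ℚ ≤ℚ q → √approx n q + precision n ≤ℚ r → q <ℚ r * r
√approx-upper n {q} {r} 0≤q s≤r = begin-strict
  q                  ≡⟨ ℚ.0≤p⇒∣p∣≡p 0≤q ⟨
  ∣ q ∣              <⟨ <[√approx+precision]² n q ⟩
  s * s              ≤⟨ p*p≤q*q (ℚ.nonNegative⁻¹ (√approx n q) {{√approx-nonNeg n q}}
                                  ⊕ ℚ.<⇒≤ (0<precision n)) s≤r ⟩
  r * r              ∎
  where
  open ℚ.≤-Reasoning
  s = √approx n q + precision n

√approx-lower : ∀ n {q r} → 0ℚ ≤ℚ q → 0ℚ <ℚ r → r <ℚ √approx n q → r * r <ℚ q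
√approx-lower n {q} {r} 0≤q 0<r r<s = begin-strict
  r * r                        <⟨ p*p<q*q 0<r r<s ⟩
  √approx n q * √approx n q    ≤⟨ √approx²≤ n q ⟩
  ∣ q ∣                        ≡⟨ ℚ.0≤p⇒∣p∣≡p 0≤q ⟩
  q                            ∎
  where open ℚ.≤-Reasoning

≤1⇒eventually : ∀ x {ε} → x ≤ℝ 1ℝ → 0ℚ <ℚ ε →
  ∃ λ N → ∀ n → N ≤ n → seq x n + precision n ≤ℚ 1ℚ + ε
≤1⇒eventually x {ε} x≤1 0<ε =
  let M , x≤ = x≤1 (½ * ε) (0<½*p 0<ε)
      N , p≤ = precision-small (0<½*p 0<ε)
  in M ℕ.⊔ N , λ n ≤n → begin
    seq x n + precision n      ≤⟨ ℚ.+-mono-≤ (x≤ n (ℕ.m⊔n≤o⇒m≤o M N ≤n)) (p≤ n (ℕ.m⊔n≤o⇒n≤o M N ≤n)) ⟩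
    1ℚ + ½ * ε + ½ * ε         ≡⟨ ℚ.+-assoc 1ℚ (½ * ε) (½ * ε) ⟩
    1ℚ + (½ * ε + ½ * ε)       ≡⟨ cong (1ℚ +_) (½+½ ε) ⟩
    1ℚ + ε                     ∎
  where open ℚ.≤-Reasoning

-- A term above 1 + ε, past the Cauchy bound for ε/2, forces all terms past that bound above 1 +
-- ε/2. Stating the margin for all large `m` makes the property monotone in `M`.
≰1⇒eventually : ∀ x → ¬ x ≤ℝ 1ℝ → ¬ ¬ ∃ λ M →
  ∀ m n → M ≤ m → M ≤ n → 1ℚ + precision m <ℚ seq x n
≰1⇒eventually x x≰1 k = x≰1 λ ε 0<ε →
  let h = ½ * ε
      M , x≈ = isCauchy x h (0<½*p 0<ε)
      N , p≤ = precision-small (0<½*p 0<ε)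
  in M , λ l M≤l → ℚ.≮⇒≥ λ 1+ε<x → k (M ℕ.⊔ N , λ m n ≤m ≤n → begin-strict
    1ℚ + precision m                ≤⟨ ℚ.+-monoʳ-≤ 1ℚ (p≤ m (ℕ.m⊔n≤o⇒n≤o M N ≤m)) ⟩
    1ℚ + h                          ≡⟨ solve 1 (λ h → con 1ℚ :+ h := con 1ℚ :+ (h :+ h) :- h) refl h ⟩
    1ℚ + (h + h) - h                ≡⟨ cong (λ e → 1ℚ + e - h) (½+½ ε) ⟩
    1ℚ + ε - h                      <⟨ ℚ.+-mono-< 1+ε<x (ℚ.neg-antimono-< (ℚ.≤-<-trans (p≤∣p∣ _)
                                         (x≈ l n M≤l (ℕ.m⊔n≤o⇒m≤o M N ≤n)))) ⟩
    seq x l - (seq x l - seq x n)   ≡⟨ solve 2 (λ y z → y :- (y :- z) := z) refl (seq x l) (seq x n) ⟩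
    seq x n                         ∎)
  where
  open ℚ.≤-Reasoning
  open +-*-Solver

module _ (G : Graph) where
  open Graph G

  RationalModel : Set
  RationalModel = ∃ λ R → ∃ λ (p : Vertex → Point) → ∀ u v → u ≢ v →
    (Adj u v → sq (p u) (p v) ≤ℚ R) × (¬ Adj u v → R <ℚ sq (p u) (p v))

  -- First `M` is chosen so that all non-edges eventually exceed 1 + `precision M`, then `N` so that
  -- the edges stay within it, including the approximation error. The coordinates at index `M ⊔ N`
  -- are then separated by the square of that number.
  rational-model : IsUDG G → ¬ ¬ RationalModel
  rational-model (f , f-udg) k =
    ¬¬-uniform₂ (λ u v M → u ≢ v → ¬ Adj u v →
                                 ∀ m n → M ≤ m → M ≤ n → 1ℚ + precision m <ℚ d u v n)
      (λ u v M≤N far u≢v ¬uv m n N≤m N≤n →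
        far u≢v ¬uv m n (ℕ.≤-trans M≤N N≤m) (ℕ.≤-trans M≤N N≤n))
      -- The bound 0 is provisional: once the premises are supplied to it, a true bound is found and
      -- given to `k` instead.
      (λ u v k → k (0 , λ u≢v ¬uv → ⊥-elim
        (≰1⇒eventually (dist (f u) (f v)) (¬uv ∘ Equivalence.from (f-udg u v u≢v))
          λ (M , far) → k (M , λ _ _ → far))))
      λ (M , far) →
    ¬¬-uniform₂ (λ u v N → u ≢ v → Adj u v → ∀ n → N ≤ n → d u v n + precision n ≤ℚ 1ℚ + precision M)
      (λ u v M≤N near u≢v uv n N≤n → near u≢v uv n (ℕ.≤-trans M≤N N≤n))
      (λ u v k → k (0 , λ u≢v uv → ⊥-elim
        (let N , near = ≤1⇒eventually (dist (f u) (f v))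
                          (Equivalence.to (f-udg u v u≢v) uv) (0<precision M)
         in k (N , λ _ _ → near))))
      λ (N , near) →
    let n   = M ℕ.⊔ N
        1+ε = 1ℚ + precision M
        p   = λ u → seq (proj₁ (f u)) n , seq (proj₂ (f u)) n
        0≤q = λ u v → 0≤sq (p u) (p v)
    in k (1+ε * 1+ε , p , λ u v u≢v →
        (λ uv → ℚ.<⇒≤ (√approx-upper n (0≤q u v) (near u v u≢v uv n (ℕ.m≤n⊔m M N))))
      , (λ ¬uv → √approx-lower n (0≤q u v) (ℚ.positive⁻¹ 1ℚ ⊞ ℚ.<⇒≤ (0<precision M))
                   (far u v u≢v ¬uv M n ℕ.≤-refl (ℕ.m≤m⊔n M N))))
    where
    d : Vertex → Vertex → ℕ → ℚ
    d u v n = seq (dist (f u) (f v)) n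

-- Unit disk graphs drawn with rational coordinates.

element-∈ : ∀ {n} (S : Subset n) i → element S i ∈ S
element-∈ (outside ∷ S) i       = there (element-∈ S i)
element-∈ (inside  ∷ S) zero    = here
element-∈ (inside  ∷ S) (suc i) = there (element-∈ S i)

element-injective : ∀ {n} (S : Subset n) {i j} → element S i ≡ element S j → i ≡ j
element-injective (outside ∷ S) eq = element-injective S (Fin.suc-injective eq)
element-injective (inside  ∷ S) {zero}  {zero}  eq = refl
element-injective (inside  ∷ S) {suc i} {suc j} eq =
  cong suc (element-injective S (Fin.suc-injective eq))

fromℚ² : Point → ℝ²
fromℚ² (x , y) = fromℚ x , fromℚ y

sq≤1⇒dist≤1 : ∀ P Q → sq P Q ≤ℚ 1ℚ → dist (fromℚ² P) (fromℚ² Q) ≤ℝ 1ℝ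
sq≤1⇒dist≤1 P Q sq≤1 ε 0<ε = 0 , λ n _ → ℚ.≤-trans
  (ℚ.≮⇒≥ λ 1<s → ℚ.<-irrefl refl
    (ℚ.<-≤-trans (√approx-lower n (0≤sq P Q) (ℚ.positive⁻¹ 1ℚ) 1<s) sq≤1))
  (ℚ.+-monoʳ-≤ 1ℚ (ℚ.<⇒≤ 0<ε))

dist≤1⇒sq<[1+ε]² : ∀ P Q → dist (fromℚ² P) (fromℚ² Q) ≤ℝ 1ℝ →
  ∀ {ε} → 0ℚ <ℚ ε → sq P Q <ℚ (1ℚ + ε) * (1ℚ + ε)
dist≤1⇒sq<[1+ε]² P Q d≤1 0<ε =
  let n , s≤ = ≤1⇒eventually (dist (fromℚ² P) (fromℚ² Q)) d≤1 0<ε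
  in √approx-upper n (0≤sq P Q) (s≤ n ℕ.≤-refl)

<[1+ε]²⇒≤1 : ∀ {p} → (∀ {ε} → 0ℚ <ℚ ε → p <ℚ (1ℚ + ε) * (1ℚ + ε)) → p ≤ℚ 1ℚ
<[1+ε]²⇒≤1 {p} p< = ℚ.≮⇒≥ λ 1<p → absurd (p<q⇒0<q-p 1<p)
  where
  open ℚ.≤-Reasoning
  open +-*-Solver
  t = p - 1ℚ
  -- For 0 < t ≤ 3, take ε = t/3, as (1 + t/3)² + (t/9)(3 - t) = 1 + t. For t > 3, ε = 1 suffices.
  1/3 = ℤ.+ 1 / 3
  1/9 = ℤ.+ 1 / 9
  absurd : ¬ 0ℚ <ℚ t
  absurd 0<t with t ℚ.≤? ℤ.+ 3 / 1
  ... | yes t≤3 = ℚ.<-irrefl refl (begin-strict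
    p                                                  <⟨ p< (0<p*q (ℚ.positive⁻¹ 1/3) 0<t) ⟩
    (1ℚ + 1/3 * t) * (1ℚ + 1/3 * t)                    ≡⟨ ℚ.+-identityʳ _ ⟨
    (1ℚ + 1/3 * t) * (1ℚ + 1/3 * t) + 0ℚ               ≤⟨ ℚ.+-monoʳ-≤ ((1ℚ + 1/3 * t) * (1ℚ + 1/3 * t))
      ((ℚ.<⇒≤ (ℚ.positive⁻¹ 1/9) ⊗ ℚ.<⇒≤ 0<t) ⊗ p≤q⇒0≤q-p t≤3) ⟩
    (1ℚ + 1/3 * t) * (1ℚ + 1/3 * t) + 1/9 * t * (ℤ.+ 3 / 1 - t)
      ≡⟨ solve 1 (λ p → let t = p :- con 1ℚ; u = con 1ℚ :+ con 1/3 :* t in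
           u :* u :+ con 1/9 :* t :* (con (ℤ.+ 3 / 1) :- t) := p) refl p ⟩
    p                                                  ∎)
  ... | no t≰3 = ℚ.<-asym (ℚ.≰⇒> t≰3) (ℚ.+-monoˡ-< (- 1ℚ) (p< (ℚ.positive⁻¹ 1ℚ)))

dist≤1⇔sq≤1 : ∀ P Q → dist (fromℚ² P) (fromℚ² Q) ≤ℝ 1ℝ ⇔ sq P Q ≤ℚ 1ℚ
dist≤1⇔sq≤1 P Q = mk⇔ (λ d≤1 → <[1+ε]²⇒≤1 (dist≤1⇒sq<[1+ε]² P Q d≤1)) (sq≤1⇒dist≤1 P Q)

·-nonNeg : ∀ n {δ} → 0ℚ ≤ℚ δ → 0ℚ ≤ℚ n · δ
·-nonNeg zero    0≤δ = ℚ.≤-refl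
·-nonNeg (suc n) 0≤δ = 0≤δ ⊕ ·-nonNeg n 0≤δ

·-mono : ∀ {m n δ} → m ≤ n → 0ℚ ≤ℚ δ → m · δ ≤ℚ n · δ
·-mono {n = n} z≤n 0≤δ = ·-nonNeg n 0≤δ
·-mono {δ = δ} (s≤s m≤n) 0≤δ = ℚ.+-monoʳ-≤ δ (·-mono m≤n 0≤δ)

unit-fraction : ∀ n → 0 ℕ.< n → ∃ λ δ → 0ℚ <ℚ δ × n · δ ≡ 1ℚ
unit-fraction (suc n) _ = 1/ m , ℚ.positive⁻¹ (1/ m) {{ℚ.1/pos⇒pos m}} , (begin
    suc n · (1/ m)            ≡⟨ cong (suc n ·_) (ℚ.*-identityˡ (1/ m)) ⟨
    suc n · (1ℚ * 1/ m)       ≡⟨ ×-assoc-* (suc n) 1ℚ (1/ m) ⟨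
    m * 1/ m                  ≡⟨ ℚ.*-inverseʳ m ⟩
    1ℚ                        ∎)
  where
  open ≡-Reasoning
  m = suc n · 1ℚ
  instance
    m-pos = positive (ℚ.positive⁻¹ 1ℚ ⊞ ·-nonNeg n (ℚ.<⇒≤ (ℚ.positive⁻¹ 1ℚ)))
    m-nonZero = ℚ.pos⇒nonZero m {{m-pos}}

-- The even cycle with both parts made cliques.

module EvenCycle⋆ {k} (k≥4 : 4 ≤ k) where

  B : BipartiteGraph
  B = evenCycle k (4≤k⇒3≤2k k≥4)

  C : Graph
  C = B ⋆

  n = 2 ℕ.* k

  8≤n : 8 ≤ n
  8≤n = ℕ.*-monoʳ-≤ 2 k≥4

  0<n : 0 ℕ.< n
  0<n = ℕ.≤-trans (s≤s z≤n) 8≤n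

  even-n : parity n ≡ parity 0
  even-n = ℙ.*-homo-* 2 k

  -- The default sends the index n back to the vertex 0, which closes the cycle.
  vertex : ℕ → Fin n
  vertex i with i ℕ.<? n
  ... | yes i<n = fromℕ< i<n
  ... | no  _   = fromℕ< 0<n

  toℕ-vertex : ∀ {i} → i ℕ.< n → toℕ (vertex i) ≡ i
  toℕ-vertex {i} i<n with i ℕ.<? n
  ... | yes i<n′ = Fin.toℕ-fromℕ< i<n′
  ... | no  i≮n  = contradiction i<n i≮n

  toℕ-vertex-n : toℕ (vertex n) ≡ 0
  toℕ-vertex-n with n ℕ.<? n
  ... | yes n<n = contradiction refl (ℕ.<⇒≢ n<n)
  ... | no  _   = Fin.toℕ-fromℕ< 0<n

  vertex≢ : ∀ {i j} → i ℕ.< j → j ≤ n → j ℕ.< i ℕ.+ n → vertex i ≢ vertex j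
  vertex≢ {i} {j} i<j j≤n j<i+n eq with ℕ.m≤n⇒m<n∨m≡n j≤n
  ... | inj₁ j<n  = ℕ.<⇒≢ i<j (trans (sym (toℕ-vertex (ℕ.<-trans i<j j<n)))
                      (trans (cong toℕ eq) (toℕ-vertex j<n)))
  ... | inj₂ refl with refl ← trans (sym (toℕ-vertex i<j)) (trans (cong toℕ eq) toℕ-vertex-n)
    = ℕ.<-irrefl refl j<i+n

  parity-vertex : ∀ {i} → i ≤ n → parity (toℕ (vertex i)) ≡ parity i
  parity-vertex i≤n with ℕ.m≤n⇒m<n∨m≡n i≤n
  ... | inj₁ i<n  = cong parity (toℕ-vertex i<n)
  ... | inj₂ refl = trans (cong parity toℕ-vertex-n) (sym even-n)

  vertex-next : ∀ {i} → i ℕ.< n → Next (vertex i) (vertex (suc i))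
  vertex-next {i} i<n with ℕ.m≤n⇒m<n∨m≡n i<n
  ... | inj₁ 1+i<n = inj₁ (trans (cong suc (toℕ-vertex i<n)) (sym (toℕ-vertex 1+i<n)))
  ... | inj₂ 1+i≡n = inj₂ (trans (cong suc (toℕ-vertex i<n)) 1+i≡n
                          , trans (cong (toℕ ∘ vertex) 1+i≡n) toℕ-vertex-n)

  vertex-apart : ∀ {i j} → i ℕ.< j → j ≤ n → suc i ≢ j → suc j ≢ i ℕ.+ n →
    ¬ (Next (vertex i) (vertex j) ⊎ Next (vertex j) (vertex i))
  vertex-apart {i} {j} i<j j≤n 1+i≢j 1+j≢i+n uv with ℕ.m≤n⇒m<n∨m≡n j≤n
  ... | inj₁ j<n rewrite toℕ-vertex (ℕ.<-trans i<j j<n) | toℕ-vertex j<n = go uv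
    where
    go : ¬ ((suc i ≡ j ⊎ suc i ≡ n × j ≡ 0) ⊎ (suc j ≡ i ⊎ suc j ≡ n × i ≡ 0))
    go (inj₁ (inj₁ eq))        = 1+i≢j eq
    go (inj₁ (inj₂ (_ , j≡0))) = ℕ.n≮0 (subst (i ℕ.<_) j≡0 i<j)
    go (inj₂ (inj₁ eq))        = ℕ.<-asym i<j (ℕ.≤-reflexive eq)
    go (inj₂ (inj₂ (eq , refl))) = 1+j≢i+n eq
  ... | inj₂ refl rewrite toℕ-vertex i<j | toℕ-vertex-n = go uv
    where
    go : ¬ ((suc i ≡ 0 ⊎ suc i ≡ n × 0 ≡ 0) ⊎ (1 ≡ i ⊎ 1 ≡ n × i ≡ 0))
    go (inj₁ (inj₂ (eq , _))) = 1+i≢j eq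
    go (inj₂ (inj₁ eq))       = 1+j≢i+n (cong (ℕ._+ n) eq)
    go (inj₂ (inj₂ (eq , _))) = ℕ.<⇒≢ (ℕ.≤-trans (s≤s (s≤s z≤n)) 8≤n) eq

  cycle-points : ∀ {R} {P : Fin n → Point} →
    (∀ u v → u ≢ v → (Graph.Adj C u v → sq (P u) (P v) ≤ℚ R) ×
                     (¬ Graph.Adj C u v → R <ℚ sq (P u) (P v))) →
    CyclePoints R n (P ∘ vertex)
  cycle-points {R} {P} model = record
    { closed  = cong P (Fin.toℕ-injective (trans toℕ-vertex-n (sym (toℕ-vertex 0<n))))
    ; similar = λ i<j j≤n j<i+n eq →
        let u≢v = vertex≢ i<j j≤n j<i+n
        in proj₁ (model _ _ u≢v) (u≢v , inj₁ (trans (parity-vertex (ℕ.≤-trans (ℕ.<⇒≤ i<j) j≤n))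
             (trans eq (sym (parity-vertex j≤n)))))
    ; next    = λ {i} i<n →
        let u≢v = λ eq → Graph.Adj-irrefl (BipartiteGraph.graph B) eq (inj₁ (vertex-next i<n))
        in proj₁ (model _ _ u≢v) (u≢v , inj₂ (inj₁ (vertex-next i<n)))
    ; apart   = λ {i} {j} i<j j≤n odd 1+i≢j 1+j≢i+n →
        let parity≢ = λ eq → odd (trans (sym (parity-vertex (ℕ.≤-trans (ℕ.<⇒≤ i<j) j≤n)))
                                   (trans eq (parity-vertex j≤n)))
        in proj₂ (model (vertex i) (vertex j) (parity≢ ∘ cong (parity ∘ toℕ)))
             λ (_ , uv) → [ parity≢ , vertex-apart i<j j≤n 1+i≢j 1+j≢i+n ]′ uv
    }

  not-UDG : ¬ IsUDG C
  not-UDG udg = rational-model C udg λ (R , P , model) → no-cycle 8≤n (cycle-points {P = P} model)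

  -- Away from v the cycle is a path: label numbers its vertices consecutively, starting just after v.
  -- They are placed at distance δ = 1/n along two horizontal lines, one for each part, at height
  -- difference 1 - δ².
  module Path (v : Fin n) where

    label : Fin n → ℕ
    label a with toℕ v ℕ.<? toℕ a
    ... | yes _ = toℕ a
    ... | no  _ = toℕ a ℕ.+ n

    label-range : ∀ {a} → a ≢ v → toℕ v ℕ.< label a × label a ℕ.< toℕ v ℕ.+ n
    label-range {a} a≢v with toℕ v ℕ.<? toℕ a
    ... | yes v<a = v<a , ℕ.<-≤-trans (Fin.toℕ<n a) (ℕ.m≤n+m n (toℕ v))
    ... | no  v≮a = ℕ.<-≤-trans (Fin.toℕ<n v) (ℕ.m≤n+m n (toℕ a))
                  , ℕ.+-monoˡ-< n (ℕ.≤∧≢⇒< (ℕ.≮⇒≥ v≮a) (a≢v ∘ Fin.toℕ-injective))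

    not-large : ∀ (a : Fin n) m → toℕ a ≢ m ℕ.+ n
    not-large a m eq = ℕ.<⇒≱ (Fin.toℕ<n a) (subst (n ≤_) (sym eq) (ℕ.m≤n+m n m))

    label-injective : ∀ {a b} → label a ≡ label b → a ≡ b
    label-injective {a} {b} eq with toℕ v ℕ.<? toℕ a | toℕ v ℕ.<? toℕ b
    ... | yes _ | yes _ = Fin.toℕ-injective eq
    ... | yes _ | no  _ = contradiction eq (not-large a (toℕ b))
    ... | no  _ | yes _ = contradiction (sym eq) (not-large b (toℕ a))
    ... | no  _ | no  _ = Fin.toℕ-injective (ℕ.+-cancelʳ-≡ n _ _ eq)

    -- The numbering breaks only between v and its successor; the shift by n absorbs the step from n
    -- - 1 to 0.
    next⇒label : ∀ {a b} → a ≢ v → b ≢ v → Next a b → suc (label a) ≡ label b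
    next⇒label {a} {b} a≢v b≢v next with toℕ v ℕ.<? toℕ a | toℕ v ℕ.<? toℕ b | next
    ... | yes _   | yes _   | inj₁ eq = eq
    ... | yes v<a | no  v≮b | inj₁ eq = contradiction (ℕ.m<n⇒m<1+n v<a) (v≮b ∘ subst (toℕ v ℕ.<_) eq)
    ... | no  v≮a | yes v<b | inj₁ eq = contradiction (Fin.toℕ-injective
        (ℕ.≤-antisym (ℕ.≮⇒≥ v≮a) (ℕ.s≤s⁻¹ (subst (toℕ v ℕ.<_) (sym eq) v<b)))) a≢v
    ... | no  _   | no  _   | inj₁ eq = cong (ℕ._+ n) eq
    ... | _       | yes v<b | inj₂ (_ , b≡0) = contradiction (subst (toℕ v ℕ.<_) b≡0 v<b) ℕ.n≮0
    ... | yes _   | no  _   | inj₂ (eq , b≡0) = trans eq (cong (ℕ._+ n) (sym b≡0))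
    ... | no  v≮a | no  _   | inj₂ (eq , _) = contradiction (Fin.toℕ-injective
        (ℕ.≤-antisym (ℕ.≮⇒≥ v≮a) (ℕ.s≤s⁻¹ (subst (toℕ v ℕ.<_) (sym eq) (Fin.toℕ<n v))))) a≢v

    label⇒next : ∀ {a b} → suc (label a) ≡ label b → Next a b
    label⇒next {a} {b} eq with toℕ v ℕ.<? toℕ a | toℕ v ℕ.<? toℕ b
    ... | yes _ | yes _ = inj₁ eq
    ... | yes _ | no  _ = inj₂ (trans eq (cong (ℕ._+ n) b≡0) , b≡0)
      where
      b≡0 : toℕ b ≡ 0
      b≡0 = ℕ.n≤0⇒n≡0 (ℕ.+-cancelʳ-≤ n (toℕ b) 0 (subst (_≤ n) eq (Fin.toℕ<n a)))
    ... | no  _ | yes _ = contradiction (sym eq) (not-large b (suc (toℕ a)))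
    ... | no  _ | no  _ = inj₁ (ℕ.+-cancelʳ-≡ n _ _ eq)

    δ : ℚ
    δ = proj₁ (unit-fraction n 0<n)

    0<δ : 0ℚ <ℚ δ
    0<δ = proj₁ (proj₂ (unit-fraction n 0<n))

    0≤δ : 0ℚ ≤ℚ δ
    0≤δ = ℚ.<⇒≤ 0<δ

    n·δ≡1 : n · δ ≡ 1ℚ
    n·δ≡1 = proj₂ (proj₂ (unit-fraction n 0<n))

    height : Parity → ℚ
    height 0ℙ = 0ℚ
    height 1ℙ = 1ℚ - δ * δ

    place : Fin n → Point
    place a = label a · δ , height (parity (toℕ a))

    gap : ℕ → ℚ
    gap d = d · δ

    sq-place : ∀ a b d → label b ≡ label a ℕ.+ d →
      let h = height (parity (toℕ a)) - height (parity (toℕ b))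
      in sq (place a) (place b) ≡ gap d * gap d + h * h
    sq-place a b d eq = trans
      (cong (λ x → (label a · δ - x) * (label a · δ - x) + h * h)
        (trans (cong (_· δ) eq) (×-homo-+ δ (label a) d)))
      (solve 3 (λ x y h → (x :- (x :+ y)) :* (x :- (x :+ y)) :+ h := y :* y :+ h) refl
         (label a · δ) (gap d) (h * h))
      where
      open +-*-Solver
      h = height (parity (toℕ a)) - height (parity (toℕ b))

    -- For two vertices of one part: their labels differ by at most n, and n steps of δ have length
    -- 1.
    gap≤1 : ∀ {d} → d ≤ n → gap d * gap d ≤ℚ 1ℚ
    gap≤1 {d} d≤n = p*p≤q*q {gap d} {1ℚ} (·-nonNeg d 0≤δ) (subst (gap d ≤ℚ_) n·δ≡1 (·-mono d≤n 0≤δ))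

    h² : ∀ {s t} → s ≢ t → (height s - height t) * (height s - height t) ≡ (1ℚ - δ * δ) * (1ℚ - δ * δ)
    h² {0ℙ} {0ℙ} s≢t = contradiction refl s≢t
    h² {0ℙ} {1ℙ} _   = solve 1 (λ δ → let h = con 1ℚ :- δ :* δ in
      (con 0ℚ :- h) :* (con 0ℚ :- h) := h :* h) refl δ where open +-*-Solver
    h² {1ℙ} {0ℙ} _   = solve 1 (λ δ → let h = con 1ℚ :- δ :* δ in
      (h :- con 0ℚ) :* (h :- con 0ℚ) := h :* h) refl δ where open +-*-Solver
    h² {1ℙ} {1ℙ} s≢t = contradiction refl s≢t

    -- The sum is 1 - δ²(1 - δ²), where δ ≤ 1.
    consecutive : gap 1 * gap 1 + (1ℚ - δ * δ) * (1ℚ - δ * δ) ≤ℚ 1ℚ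
    consecutive = begin
      lhs                                   ≡⟨ ℚ.+-identityʳ lhs ⟨
      lhs + 0ℚ                              ≤⟨ ℚ.+-monoʳ-≤ lhs (0≤p*p δ ⊗ p≤q⇒0≤q-p (gap≤1 0<n)) ⟩
      lhs + δ * δ * (1ℚ - gap 1 * gap 1)    ≡⟨ solve 1 (λ δ → let g = δ :+ con 0ℚ; h = con 1ℚ :- δ :* δ in
        g :* g :+ h :* h :+ δ :* δ :* (con 1ℚ :- g :* g) := con 1ℚ) refl δ ⟩
      1ℚ                                    ∎
      where
      open ℚ.≤-Reasoning
      open +-*-Solver
      lhs = gap 1 * gap 1 + (1ℚ - δ * δ) * (1ℚ - δ * δ)

    -- For a gap of 2δ the sum is 1 + 2δ² + δ⁴, and larger gaps only increase it.
    distant : ∀ {d} → 2 ≤ d → 1ℚ <ℚ gap d * gap d + (1ℚ - δ * δ) * (1ℚ - δ * δ)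
    distant {d} 2≤d = begin-strict
      1ℚ                                       ≡⟨ ℚ.+-identityʳ 1ℚ ⟨
      1ℚ + 0ℚ                                  <⟨ ℚ.+-monoʳ-< 1ℚ (0<p*q 0<δ 0<δ ⊞ 0≤p*p δ ⊞ 0≤p*p (δ * δ)) ⟩
      1ℚ + (δ * δ + δ * δ + δ * δ * (δ * δ))   ≡⟨ solve 1 (λ δ →
        let g = δ :+ (δ :+ con 0ℚ); h = con 1ℚ :- δ :* δ in
        con 1ℚ :+ (δ :* δ :+ δ :* δ :+ δ :* δ :* (δ :* δ)) := g :* g :+ h :* h) refl δ ⟩
      gap 2 * gap 2 + (1ℚ - δ * δ) * (1ℚ - δ * δ)
        ≤⟨ ℚ.+-monoˡ-≤ ((1ℚ - δ * δ) * (1ℚ - δ * δ)) (p*p≤q*q (·-nonNeg 2 0≤δ) (·-mono 2≤d 0≤δ)) ⟩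
      gap d * gap d + (1ℚ - δ * δ) * (1ℚ - δ * δ) ∎
      where
      open ℚ.≤-Reasoning
      open +-*-Solver

    -- Within a part all distances are at most 1; across the parts, exactly those between
    -- consecutive labels, which are the edges of the path.
    place-adj< : ∀ {a b} → a ≢ v → b ≢ v → label a ℕ.< label b →
      Graph.Adj C a b ⇔ sq (place a) (place b) ≤ℚ 1ℚ
    place-adj< {a} {b} a≢v b≢v a<b with parity (toℕ a) ℙ.≟ parity (toℕ b) | label b ℕ.≟ suc (label a)
    ... | yes same | _ = mk⇔
        (λ _ → subst (_≤ℚ 1ℚ) (sym (trans (sq-place a b d label-b) (trans
          (cong (λ s → gap d * gap d + (height s - height t) * (height s - height t)) same)
          (solve 2 (λ g h → g :+ (h :- h) :* (h :- h) := g) refl (gap d * gap d) (height t)))))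
          (gap≤1 d≤n))
        (λ _ → a≢b , inj₁ same)
      where
      open +-*-Solver
      t = parity (toℕ b)
      d = label b ℕ.∸ label a
      label-b : label b ≡ label a ℕ.+ d
      label-b = sym (ℕ.m+[n∸m]≡n (ℕ.<⇒≤ a<b))
      d≤n : d ≤ n
      d≤n = ℕ.≤-trans (ℕ.∸-mono (ℕ.<⇒≤ (proj₂ (label-range b≢v))) (ℕ.<⇒≤ (proj₁ (label-range a≢v))))
              (ℕ.≤-reflexive (ℕ.m+n∸m≡n (toℕ v) n))
      a≢b : a ≢ b
      a≢b a≡b = ℕ.<⇒≢ a<b (cong label a≡b)
    ... | no diff | yes eq = mk⇔
        (λ _ → subst (_≤ℚ 1ℚ) (sym (trans (sq-place a b 1 (trans eq (ℕ.+-comm 1 (label a))))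
          (cong (gap 1 * gap 1 +_) (h² diff)))) consecutive)
        (λ _ → (λ a≡b → ℕ.<⇒≢ a<b (cong label a≡b)) , inj₂ (inj₁ (label⇒next (sym eq))))
    ... | no diff | no ≢suc = mk⇔
        (λ { (_ , inj₁ same) → contradiction same diff
           ; (_ , inj₂ (inj₁ next)) → contradiction (sym (next⇒label a≢v b≢v next)) ≢suc
           ; (_ , inj₂ (inj₂ next)) →
               contradiction (ℕ.≤-reflexive (next⇒label b≢v a≢v next)) (ℕ.<-asym a<b) })
        (λ sq≤1 → contradiction (ℚ.<-≤-trans (distant 2≤d) (subst (_≤ℚ 1ℚ)
          (trans (sq-place a b d label-b) (cong (gap d * gap d +_) (h² diff))) sq≤1)) (ℚ.<-irrefl refl))
      where
      d = label b ℕ.∸ label a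
      label-b : label b ≡ label a ℕ.+ d
      label-b = sym (ℕ.m+[n∸m]≡n (ℕ.<⇒≤ a<b))
      2≤d : 2 ≤ d
      2≤d = ℕ.m+n≤o⇒m≤o∸n 2 (ℕ.≤∧≢⇒< a<b (≢suc ∘ sym))

    place-adj : ∀ {a b} → a ≢ v → b ≢ v → a ≢ b → Graph.Adj C a b ⇔ sq (place a) (place b) ≤ℚ 1ℚ
    place-adj {a} {b} a≢v b≢v a≢b with ℕ.<-cmp (label a) (label b)
    ... | tri< a<b _ _ = place-adj< a≢v b≢v a<b
    ... | tri≈ _ a≡b _ = contradiction (label-injective a≡b) a≢b
    ... | tri> _ _ b<a = mk⇔
      (subst (_≤ℚ 1ℚ) (sq-sym (place b) (place a)) ∘ Equivalence.to (place-adj< b≢v a≢v b<a)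
        ∘ Graph.Adj-sym C)
      (Graph.Adj-sym C ∘ Equivalence.from (place-adj< b≢v a≢v b<a)
        ∘ subst (_≤ℚ 1ℚ) (sq-sym (place a) (place b)))

    induced-UDG : ∀ (S : Subset n) → ¬ v ∈ S → IsUDG (induced C S)
    induced-UDG S v∉S = fromℚ² ∘ place ∘ element S , λ i j i≢j →
      let P = place (element S i)
          Q = place (element S j)
          adj = place-adj (≢v i) (≢v j) (i≢j ∘ element-injective S)
          dist≤1 = dist≤1⇔sq≤1 P Q
      in mk⇔ (Equivalence.from dist≤1 ∘ Equivalence.to adj)
             (Equivalence.from adj ∘ Equivalence.to dist≤1)
      where
      ≢v : ∀ i → element S i ≢ v
      ≢v i eq = v∉S (subst (_∈ S) eq (element-∈ S i))

theorem8 : (k : ℕ) (k≥4 : 4 ≤ k) → IsMinimalNonUDG (evenCycle k (4≤k⇒3≤2k k≥4) ⋆)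
-- A proper subset omits some v, and the drawing of the path without v restricts to it.
theorem8 k k≥4 = not-UDG , λ S (_ , v , _ , v∉S) → Path.induced-UDG v S v∉S
  where open EvenCycle⋆ k≥4
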